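{- Let $P \subseteq \mathbb{R}^2$ have a rightmost column, i.e. the set of $x$-coordinates of points of $P$ has a maximum $x_0$. Let $c > 0$, let $(x_0, y_0) \in P$ be a point in the rightmost column, and let $P' = P \cup \{(x_0 + u, y_0) : 0 \le u \le c\}$ be obtained from $P$ by adding a horizontal segment of length $c$ with its left endpoint at $(x_0, y_0)$. Then $\operatorname{opx}(n, P') \le \operatorname{opx}(n, P) + cn$ for all real $n > 0$.
   Context: Containment for subsets of the plane: for $P, S \subseteq \mathbb{R}^2$, let $X_P, Y_P$ be the sets of $x$-coordinates and $y$-coordinates of points of $P$, and $X_S, Y_S$ likewise for $S$. $S$ contains $P$ if there exist functions $f_X: X_P \to X_S$ and $f_Y: Y_P \to Y_S$ such that (1) $\frac{f_X(x_0)-f_X(x_1)}{x_0-x_1} \ge 1$ for all $x_0 > x_1$ in $X_P$; (2) $\frac{f_Y(y_0)-f_Y(y_1)}{y_0-y_1} \ge 1$ for all $y_0 > y_1$ in $Y_P$; (3) $(f_X(x), f_Y(y)) \in S$ for all $(x,y) \in P$. Otherwise $S$ is $P$-free. For real $n > 0$, $\operatorname{opx}(n,P)$ is the supremum of the Lebesgue measure $\mu_2(S)$ over all open (in $\mathbb{R}^2$) $P$-free subsets $S \subseteq [0,n]^2$. The columns of $P$ are its maximal subsets with the same $x$-coordinate. -}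

module Defs where

open import Algebra.Bundles using (CommutativeRing)
open import Data.Empty using (⊥-elim)
open import Data.Fin.Base using (toℕ)
open import Data.Nat.Base as ℕ using (ℕ)
open import Data.Product using (Σ-syntax; ∃; ∃-syntax; _×_; _,_; proj₁; proj₂)
open import Data.Product.Relation.Binary.Pointwise.NonDependent using (Pointwise)
open import Function.Bundles using (Func)
open import Level using (0ℓ; Setω) renaming (suc to lsuc)
open import Relation.Binary.Bundles using (Setoid; TotalOrder)
open import Relation.Binary.Core using (Rel)
import Relation.Binary.Construct.NonStrictToStrict as ToStrict
import Relation.Binary.Construct.On as On
open import Relation.Binary.Structures using (IsTotalOrder)
open import Relation.Nullary using (¬_)
open import Relation.Unary using (Pred; Satisfiable; _⊆_; ∅)

module Bounds {A : Set} (_≤_ : Rel A 0ℓ) where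

  IsUpperBound IsLowerBound : ∀ {ℓ} → Pred A ℓ → Pred A ℓ
  IsUpperBound B u = ∀ a → B a → a ≤ u
  IsLowerBound B l = ∀ a → B a → l ≤ a

  IsSup IsInf IsMax : ∀ {ℓ} → Pred A ℓ → Pred A ℓ
  IsSup B s = IsUpperBound B s × (∀ u → IsUpperBound B u → s ≤ u)
  IsInf B i = IsLowerBound B i × (∀ l → IsLowerBound B l → l ≤ i)
  IsMax B m = B m × IsUpperBound B m

-- The library has no real numbers.  They are introduced by their categorical
-- axiomatisation as the Dedekind-complete ordered field; equality is a setoid
-- equality, since quotients are not available.  The value of `x ⁻¹` for x ≈ 0
-- is unspecified.
record CompleteOrderedField : Setω where
  infix  8 _⁻¹
  infixl 7 _/_
  infix  4 _≤_ _<_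

  field
    commutativeRing : CommutativeRing 0ℓ 0ℓ

  open CommutativeRing commutativeRing public

  field
    _⁻¹          : Carrier → Carrier
    *-inverseʳ   : ∀ x → ¬ x ≈ 0# → x * x ⁻¹ ≈ 1#
    0≉1          : ¬ 0# ≈ 1#
    _≤_          : Rel Carrier 0ℓ
    isTotalOrder : IsTotalOrder _≈_ _≤_
    +-monoˡ-≤    : ∀ z {x y} → x ≤ y → x + z ≤ y + z
    *-nonNeg     : ∀ {x y} → 0# ≤ x → 0# ≤ y → 0# ≤ x * y

  open Bounds _≤_ public

  field
    complete : ∀ {ℓ} (A : Pred Carrier ℓ) →
               Satisfiable A → Satisfiable (IsUpperBound A) → ∃ (IsSup A)

  open IsTotalOrder isTotalOrder public using ()
    renaming ( reflexive to ≤-reflexive; refl to ≤-refl; trans to ≤-trans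
             ; antisym to ≤-antisym; total to ≤-total )

  totalOrder : TotalOrder 0ℓ 0ℓ 0ℓ
  totalOrder = record { isTotalOrder = isTotalOrder }

  _<_ : Rel Carrier 0ℓ
  _<_ = ToStrict._<_ _≈_ _≤_

  _/_ : Carrier → Carrier → Carrier
  x / y = x * y ⁻¹

  infimum : ∀ {ℓ} (A : Pred Carrier ℓ) →
            Satisfiable A → Satisfiable (IsLowerBound A) → ∃ (IsInf A)
  infimum A (a , a∈A) bounded
    with complete (IsLowerBound A) bounded (a , λ l l≤ → l≤ a a∈A)
  ... | i , upper , least =
    i , (λ b b∈A → least b λ l l≤ → l≤ b b∈A) , upper

module Plane (ℝ : CompleteOrderedField) where

  open CompleteOrderedField ℝ
  open import Algebra.Properties.CommutativeMonoid.Sum +-commutativeMonoid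
    using (sum; sum-syntax; sum-cong-≋; sum-replicate-zero)

  Point : Set
  Point = Carrier × Carrier

  infix 4 _≈₂_
  _≈₂_ : Rel Point 0ℓ
  _≈₂_ = Pointwise _≈_ _≈_

  -- Sets of points need not respect _≈₂_ by definition; open sets do
  -- automatically (points equal up to _≈₂_ have distance 0).
  Region : Set₁
  Region = Pred Point 0ℓ

  dist² : Point → Point → Carrier
  dist² (x , y) (x′ , y′) = (x - x′) * (x - x′) + (y - y′) * (y - y′)

  IsOpen : Region → Set
  IsOpen S = ∀ p → S p → ∃[ ε ] (0# < ε × ∀ q → dist² q p < ε * ε → S q)

  Square : Carrier → Region
  Square n (x , y) = (0# ≤ x × x ≤ n) × (0# ≤ y × y ≤ n)

  ------------------------------------------------------------------------
  -- Containment

  XCoords YCoords : Region → Pred Carrier 0ℓ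
  XCoords P x = ∃[ y ] P (x , y)
  YCoords P y = ∃[ x ] P (x , y)

  SubsetSetoid : Pred Carrier 0ℓ → Setoid 0ℓ 0ℓ
  SubsetSetoid A = On.setoid {B = ∃ A} setoid proj₁

  Expanding : {A B : Pred Carrier 0ℓ} →
              Func (SubsetSetoid A) (SubsetSetoid B) → Set
  Expanding {A} f = (s t : ∃ A) → proj₁ t < proj₁ s →
    1# ≤ (proj₁ (to s) - proj₁ (to t)) / (proj₁ s - proj₁ t)
    where open Func f

  record _Contains_ (S P : Region) : Set where
    field
      fX          : Func (SubsetSetoid (XCoords P)) (SubsetSetoid (XCoords S))
      fY          : Func (SubsetSetoid (YCoords P)) (SubsetSetoid (YCoords S))
      fX-expands  : Expanding fX
      fY-expands  : Expanding fY
      maps-into   : ∀ {x y} (p : P (x , y)) →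
                    S ( proj₁ (Func.to fX (x , y , p))
                      , proj₁ (Func.to fY (y , x , p)) )

  _IsFreeOf_ : Region → Region → Set
  S IsFreeOf P = ¬ (S Contains P)

  ------------------------------------------------------------------------
  -- Lebesgue measure

  record Rectangle : Set where
    field
      left right bottom top : Carrier
      left≤right            : left ≤ right
      bottom≤top            : bottom ≤ top

  open Rectangle

  ⟦_⟧ : Rectangle → Region
  ⟦ R ⟧ (x , y) = (left R ≤ x × x ≤ right R) × (bottom R ≤ y × y ≤ top R)

  area : Rectangle → Carrier
  area R = (right R - left R) * (top R - bottom R)

  Covers : (ℕ → Rectangle) → Region → Set
  Covers R S = ∀ {p} → S p → ∃[ i ] ⟦ R i ⟧ p

  -- The terms are nonnegative, so the sum of the series is the supremum of
  -- its partial sums.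
  HasTotalArea : (ℕ → Rectangle) → Pred Carrier 0ℓ
  HasTotalArea R = IsSup λ t → ∃[ k ] t ≈ ∑[ i < k ] area (R (toℕ i))

  -- Divergent covers are left out: they do not affect the infimum as soon as
  -- one cover has finite total area.
  CoverArea : Region → Pred Carrier 0ℓ
  CoverArea S a = ∃[ R ] (Covers R S × HasTotalArea R a)

  private

    0≤y-x : ∀ {x y} → x ≤ y → 0# ≤ y - x
    0≤y-x {x} x≤y =
      ≤-trans (≤-reflexive (sym (-‿inverseʳ x))) (+-monoˡ-≤ (- x) x≤y)

    area-nonNeg : ∀ R → 0# ≤ area R
    area-nonNeg R = *-nonNeg (0≤y-x (left≤right R)) (0≤y-x (bottom≤top R))

    0-bounds-CoverArea : ∀ S → IsLowerBound (CoverArea S) 0#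
    0-bounds-CoverArea S a (R , _ , upper , _) = upper 0# (0 , refl)

  -- Lebesgue outer measure, for sets of finite outer measure.  On measurable
  -- sets, in particular on open sets, this is Lebesgue measure.
  μ₂ : (S : Region) → Satisfiable (CoverArea S) → Carrier
  μ₂ S finite = proj₁ (infimum (CoverArea S) finite (0# , 0-bounds-CoverArea S))

  μ₂-isInf : ∀ S finite → IsInf (CoverArea S) (μ₂ S finite)
  μ₂-isInf S finite =
    proj₂ (infimum (CoverArea S) finite (0# , 0-bounds-CoverArea S))

  module _ {n : Carrier} (0≤n : 0# ≤ n) where

    private

      fullSquare origin : Rectangle
      fullSquare = record
        { left = 0# ; right = n ; bottom = 0# ; top = n
        ; left≤right = 0≤n ; bottom≤top = 0≤n }
      origin = record
        { left = 0# ; right = 0# ; bottom = 0# ; top = 0#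
        ; left≤right = ≤-refl ; bottom≤top = ≤-refl }

      cover : ℕ → Rectangle
      cover ℕ.zero    = fullSquare
      cover (ℕ.suc _) = origin

      area-origin : area origin ≈ 0#
      area-origin = trans (*-congʳ (-‿inverseʳ 0#)) (zeroˡ _)

      partialSum-suc : ∀ k →
        ∑[ i < ℕ.suc k ] area (cover (toℕ i)) ≈ area fullSquare
      partialSum-suc k = trans
        (+-congˡ (trans (sum-cong-≋ {k} λ _ → area-origin)
                        (sum-replicate-zero k)))
        (+-identityʳ _)

      total : HasTotalArea cover (area fullSquare)
      total = upper , λ u u≥ → u≥ _ (1 , sym (partialSum-suc 0))
        where
        upper : IsUpperBound _ (area fullSquare)
        upper t (ℕ.zero  , t≈) = ≤-trans (≤-reflexive t≈) (area-nonNeg fullSquare)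
        upper t (ℕ.suc k , t≈) = ≤-reflexive (trans t≈ (partialSum-suc k))

      square-CoverArea : ∀ {S} → S ⊆ Square n → CoverArea S (area fullSquare)
      square-CoverArea S⊆ = cover , (λ p → 0 , S⊆ p) , total

    finite : ∀ {S} → S ⊆ Square n → Satisfiable (CoverArea S)
    finite S⊆ = area fullSquare , square-CoverArea S⊆

    μ₂≤n² : ∀ {S} (S⊆ : S ⊆ Square n) → μ₂ S (finite S⊆) ≤ (n - 0#) * (n - 0#)
    μ₂≤n² {S} S⊆ = proj₁ (μ₂-isInf S (finite S⊆)) _ (square-CoverArea S⊆)

  ------------------------------------------------------------------------
  -- The extremal function

  FreeMeasure : ∀ {n} → 0# < n → Region → Pred Carrier (lsuc 0ℓ)
  FreeMeasure {n} (0≤n , _) P m =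
    ∃[ S ] (IsOpen S × S IsFreeOf P ×
      Σ[ S⊆ ∈ S ⊆ Square n ] m ≈ μ₂ S (finite 0≤n S⊆))

  private

    opx-exists : ∀ {n} (0<n : 0# < n) P → Satisfiable P →
                 ∃ (IsSup (FreeMeasure 0<n P))
    opx-exists (0≤n , _) P (_ , p) = complete _
      ( _ , ∅ , (λ _ ())
      , (λ c → ⊥-elim (_Contains_.maps-into c p))
      , (λ ()) , refl )
      ( _ , λ { m (_ , _ , _ , S⊆ , m≈) →
                ≤-trans (≤-reflexive m≈) (μ₂≤n² 0≤n S⊆) } )

  -- P must be nonempty: every set contains the empty set, so for P = ∅ the
  -- supremum would be over no sets at all.
  opx : ∀ {n} → 0# < n → (P : Region) → Satisfiable P → Carrier
  opx 0<n P nonempty = proj₁ (opx-exists 0<n P nonempty)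

  opx-isSup : ∀ {n} (0<n : 0# < n) P nonempty →
              IsSup (FreeMeasure 0<n P) (opx 0<n P nonempty)
  opx-isSup 0<n P nonempty = proj₂ (opx-exists 0<n P nonempty)

  HorizontalSegment : Carrier → Point → Region
  HorizontalSegment c (x₀ , y₀) p =
    ∃[ u ] (0# ≤ u × u ≤ c × p ≈₂ (x₀ + u , y₀))

{-# OPTIONS --safe #-}

-- Let S be open and free of P′, the set P with the segment added.  Its core is
-- the union of the open boxes all of whose points lie in S and have more than
-- c of S strictly to their right in their row.  A containment of P in the core
-- extends to one of P′ in S, by laying the segment out, with jumps, in that
-- room; so the core is open and P-free.
--
-- It remains to show μ(S) ≤ μ(core) + cn, without Fubini's theorem.  Take the
-- grid of mesh h = n / 2ᵏ and the cells contained in S.  A cell with cells of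
-- total width ≥ c to its right has its interior in the core; the other ones
-- have width at most c + h in each row, so area at most (c + h) n.  The part
-- of S outside these cells is covered by the maximal cells of finer grids
-- contained in S, whose area is a tail of a convergent series.  So every cover
-- of the core extends to one of S with at most (c + h) n plus that tail more
-- area, and k is arbitrary.
module Submission where

open import Defs
open import Axiom.ExcludedMiddle using (ExcludedMiddle)
open import Data.Empty using (⊥-elim)
open import Data.Fin.Base using (toℕ)
open import Data.List.Base using (List; []; _∷_; _++_; foldr; concatMap)
open import Data.List.Membership.Propositional using (_∈_; find; lose)
open import Data.List.Relation.Unary.All as All using (All; []; _∷_)
open import Data.List.Relation.Unary.Any.Properties
  using (++⁺ˡ; ++⁺ʳ; concatMap⁺; concatMap⁻)
open import Data.List.Relation.Unary.Any as Any using (Any; here; there)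
open import Data.Nat.Base as ℕ using (ℕ; zero; suc)
open import Data.Product using (∃; ∃-syntax; _×_; _,_; proj₁; proj₂)
open import Data.Sum using (_⊎_; inj₁; inj₂)
open import Function.Base using (_∘_)
open import Function.Bundles using (Func)
open import Level using (0ℓ)
open import Relation.Binary.Bundles using (TotalOrder)
open import Relation.Binary.Definitions using (_Respects_)
import Relation.Binary.PropositionalEquality.Core as ≡
open import Relation.Nullary using (¬_; Dec; yes; no)
open import Relation.Unary using (Pred; _⊆_; _∪_; _∩_)

-- Inequalities in a complete ordered field.

module OrderedFieldProperties
  (em : ∀ {ℓ} → ExcludedMiddle ℓ) (ℝ : CompleteOrderedField) where

  open CompleteOrderedField ℝ hiding (zero)
  open import Algebra.Properties.AbelianGroup +-abelianGroup public
    using () renaming (//-rightDividesˡ to x-y+y≈x; //-rightDividesʳ to x+y-y≈x)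
  open import Algebra.Properties.AbelianGroup +-abelianGroup
    using (⁻¹-anti-homo‿-)
  open import Algebra.Properties.Ring ring using (-‿distribʳ-*; -‿distribˡ-*; -‿involutive)
  open import Algebra.Solver.Ring.NaturalCoefficients.Default
    commutativeSemiring public using (solve; _:=_; _:+_; _:*_)
  open import Relation.Binary.Properties.TotalOrder totalOrder public
    using (≰⇒>; <⇒≱)
  open import Relation.Binary.Reasoning.PartialOrder
    (TotalOrder.poset totalOrder) public

  infix 4 _≤?_
  _≤?_ : ∀ x y → Dec (x ≤ y)
  x ≤? y = em

  ≤-<-trans : ∀ {x y z} → x ≤ y → y < z → x < z
  ≤-<-trans x≤y y<z = ≰⇒> λ z≤x → <⇒≱ y<z (≤-trans z≤x x≤y)

  <-≤-trans : ∀ {x y z} → x < y → y ≤ z → x < z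
  <-≤-trans x<y y≤z = ≰⇒> λ z≤x → <⇒≱ x<y (≤-trans y≤z z≤x)

  +-monoʳ-≤ : ∀ z {x y} → x ≤ y → z + x ≤ z + y
  +-monoʳ-≤ z {x} {y} x≤y = begin
    z + x ≈⟨ +-comm z x ⟩
    x + z ≤⟨ +-monoˡ-≤ z x≤y ⟩
    y + z ≈⟨ +-comm y z ⟩
    z + y ∎

  +-mono-≤ : ∀ {x y u v} → x ≤ y → u ≤ v → x + u ≤ y + v
  +-mono-≤ {y = y} {u = u} x≤y u≤v =
    ≤-trans (+-monoˡ-≤ u x≤y) (+-monoʳ-≤ y u≤v)

  +-cancelʳ-≤ : ∀ z {x y} → x + z ≤ y + z → x ≤ y
  +-cancelʳ-≤ z {x} {y} le = begin
    x           ≈⟨ x+y-y≈x z x ⟨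
    x + z + - z ≤⟨ +-monoˡ-≤ (- z) le ⟩
    y + z + - z ≈⟨ x+y-y≈x z y ⟩
    y           ∎

  -- Linear inequalities are deduced from others by exhibiting a semiring
  -- identity between the two sums of opposite sides.
  linear-≤ : ∀ {p q u v} → p ≤ q → u + q ≈ v + p → u ≤ v
  linear-≤ {p} {q} {u} {v} p≤q eq = +-cancelʳ-≤ p (begin
    u + p ≤⟨ +-monoʳ-≤ u p≤q ⟩
    u + q ≈⟨ eq ⟩
    v + p ∎)

  -- Contraposition of `linear-≤`: the same identity, with its sides exchanged, turns `v ≤ u` into
  -- `q ≤ p`.
  linear-< : ∀ {p q u v} → p < q → u + q ≈ v + p → u < v
  linear-< {p} {q} {u} {v} p<q eq = ≰⇒> λ v≤u → <⇒≱ p<q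
    (linear-≤ v≤u (trans (+-comm q u) (trans eq (+-comm v p))))

  x≤y⇒0≤y-x : ∀ {x y} → x ≤ y → 0# ≤ y - x
  x≤y⇒0≤y-x {x} {y} x≤y = +-cancelʳ-≤ x (begin
    0# + x    ≈⟨ +-identityˡ x ⟩
    x         ≤⟨ x≤y ⟩
    y         ≈⟨ x-y+y≈x x y ⟨
    y - x + x ∎)

  x≤x+y : ∀ {x y} → 0# ≤ y → x ≤ x + y
  x≤x+y {x} 0≤y = ≤-trans (≤-reflexive (sym (+-identityʳ x))) (+-monoʳ-≤ x 0≤y)

  *-monoˡ-≤ : ∀ {z x y} → 0# ≤ z → x ≤ y → z * x ≤ z * y
  *-monoˡ-≤ {z} {x} {y} 0≤z x≤y = begin
    z * x                   ≤⟨ x≤x+y (*-nonNeg 0≤z (x≤y⇒0≤y-x x≤y)) ⟩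
    z * x + z * (y - x)     ≈⟨ distribˡ z x (y - x) ⟨
    z * (x + (y - x))       ≈⟨ *-congˡ (trans (+-comm x (y - x)) (x-y+y≈x x y)) ⟩
    z * y                   ∎

  *-monoʳ-≤ : ∀ {z x y} → 0# ≤ z → x ≤ y → x * z ≤ y * z
  *-monoʳ-≤ {z} {x} {y} 0≤z x≤y = begin
    x * z ≈⟨ *-comm x z ⟩
    z * x ≤⟨ *-monoˡ-≤ 0≤z x≤y ⟩
    z * y ≈⟨ *-comm z y ⟩
    y * z ∎

  *-mono-≤ : ∀ {x y u v} → 0# ≤ x → 0# ≤ v → x ≤ y → u ≤ v → x * u ≤ y * v
  *-mono-≤ 0≤x 0≤v x≤y u≤v = ≤-trans (*-monoˡ-≤ 0≤x u≤v) (*-monoʳ-≤ 0≤v x≤y)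

  square-nonNeg : ∀ x → 0# ≤ x * x
  square-nonNeg x with ≤-total 0# x
  ... | inj₁ 0≤x = *-nonNeg 0≤x 0≤x
  ... | inj₂ x≤0 = begin
    0#                    ≤⟨ *-nonNeg (x≤y⇒0≤y-x x≤0) (x≤y⇒0≤y-x x≤0) ⟩
    (0# - x) * (0# - x)   ≈⟨ *-cong (+-identityˡ _) (+-identityˡ _) ⟩
    - x * - x             ≈⟨ -‿distribˡ-* x (- x) ⟨
    - (x * - x)           ≈⟨ -‿cong (-‿distribʳ-* x x) ⟨
    - - (x * x)           ≈⟨ -‿involutive (x * x) ⟩
    x * x                 ∎

  0<1 : 0# < 1#
  0<1 = ≤-trans (square-nonNeg 1#) (≤-reflexive (*-identityˡ 1#)) , 0≉1

  *-distance-comm : ∀ x y → (x - y) * (x - y) ≈ (y - x) * (y - x)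
  *-distance-comm x y = begin-equality
    (x - y) * (x - y)         ≈⟨ *-cong (⁻¹-anti-homo‿- y x) (⁻¹-anti-homo‿- y x) ⟨
    - (y - x) * - (y - x)     ≈⟨ -‿distribˡ-* _ _ ⟨
    - ((y - x) * - (y - x))   ≈⟨ -‿cong (-‿distribʳ-* _ _) ⟨
    - - ((y - x) * (y - x))   ≈⟨ -‿involutive _ ⟩
    (y - x) * (y - x)         ∎

  0<x⇒x≉0 : ∀ {x} → 0# < x → ¬ x ≈ 0#
  0<x⇒x≉0 (_ , 0≉x) x≈0 = 0≉x (sym x≈0)

  ⁻¹-nonNeg : ∀ {x} → 0# < x → 0# ≤ x ⁻¹
  ⁻¹-nonNeg {x} 0<x with 0# ≤? x ⁻¹
  ... | yes 0≤x⁻¹ = 0≤x⁻¹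
  ... | no  0≰x⁻¹ = ⊥-elim (<⇒≱ 0<1 (begin
    1#       ≈⟨ *-inverseʳ x (0<x⇒x≉0 0<x) ⟨
    x * x ⁻¹ ≤⟨ *-monoˡ-≤ (proj₁ 0<x) (proj₁ (≰⇒> 0≰x⁻¹)) ⟩
    x * 0#   ≈⟨ zeroʳ x ⟩
    0#       ∎))

  x<y⇒0<y-x : ∀ {x y} → x < y → 0# < y - x
  x<y⇒0<y-x {x} {y} x<y = linear-< x<y (begin-equality
    0# + y        ≈⟨ +-identityˡ y ⟩
    y             ≈⟨ x-y+y≈x x y ⟨
    y - x + x     ∎)

  -- Clears the denominator of the expansion condition. The additive form also makes sense when the
  -- two arguments are equal, and it is open to the semiring solver.
  slope≥1⇒ : ∀ {s t u v} → t < s → 1# ≤ (u - v) / (s - t) → s + v ≤ u + t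
  slope≥1⇒ {s} {t} {u} {v} t<s 1≤ = begin
    s + v               ≈⟨ +-congʳ (x-y+y≈x t s) ⟨
    s - t + t + v       ≤⟨ +-monoˡ-≤ v (+-monoˡ-≤ t d≤e) ⟩
    u - v + t + v       ≈⟨ solve 3 (λ x y z → x :+ y :+ z := x :+ z :+ y) refl (u - v) t v ⟩
    u - v + v + t       ≈⟨ +-congʳ (x-y+y≈x v u) ⟩
    u + t               ∎
    where
    d = s - t
    0<d = x<y⇒0<y-x t<s
    d≤e : d ≤ u - v
    d≤e = begin
      d                       ≈⟨ *-identityʳ d ⟨
      d * 1#                  ≤⟨ *-monoˡ-≤ (proj₁ 0<d) 1≤ ⟩
      d * ((u - v) * d ⁻¹)    ≈⟨ solve 3 (λ x y z → x :* (y :* z) := y :* (x :* z)) refl d (u - v) (d ⁻¹) ⟩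
      (u - v) * (d * d ⁻¹)    ≈⟨ *-congˡ (*-inverseʳ d (0<x⇒x≉0 0<d)) ⟩
      (u - v) * 1#            ≈⟨ *-identityʳ _ ⟩
      u - v                   ∎

  slope≥1⇐ : ∀ {s t u v} → t < s → s + v ≤ u + t → 1# ≤ (u - v) / (s - t)
  slope≥1⇐ {s} {t} {u} {v} t<s le = begin
    1#                ≈⟨ *-inverseʳ d (0<x⇒x≉0 0<d) ⟨
    d * d ⁻¹          ≤⟨ *-monoʳ-≤ (⁻¹-nonNeg 0<d) d≤e ⟩
    (u - v) * d ⁻¹    ∎
    where
    d = s - t
    0<d = x<y⇒0<y-x t<s
    d≤e : d ≤ u - v
    d≤e = +-cancelʳ-≤ (t + v) (begin
      d + (t + v)         ≈⟨ +-assoc d t v ⟨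
      d + t + v           ≈⟨ +-congʳ (x-y+y≈x t s) ⟩
      s + v               ≤⟨ le ⟩
      u + t               ≈⟨ +-congʳ (x-y+y≈x v u) ⟨
      u - v + v + t       ≈⟨ solve 3 (λ x y z → x :+ y :+ z := x :+ (z :+ y)) refl (u - v) v t ⟩
      u - v + (t + v)     ∎)

  *-pos : ∀ {x y} → 0# < x → 0# < y → 0# < x * y
  *-pos {x} {y} 0<x 0<y = *-nonNeg (proj₁ 0<x) (proj₁ 0<y) , λ 0≈xy →
    proj₂ 0<y (begin-equality
      0#                ≈⟨ zeroʳ (x ⁻¹) ⟨
      x ⁻¹ * 0#         ≈⟨ *-congˡ 0≈xy ⟩
      x ⁻¹ * (x * y)    ≈⟨ solve 3 (λ x y z → z :* (x :* y) := x :* z :* y) refl x y (x ⁻¹) ⟩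
      x * x ⁻¹ * y      ≈⟨ *-congʳ (*-inverseʳ x (0<x⇒x≉0 0<x)) ⟩
      1# * y            ≈⟨ *-identityˡ y ⟩
      y                 ∎)

  square-mono-< : ∀ {x y} → 0# ≤ x → x < y → x * x < y * y
  square-mono-< {x} {y} 0≤x x<y = begin-strict
    x * x                 <⟨ linear-< (*-pos (x<y⇒0<y-x x<y) 0<y) (sym (+-identityʳ _)) ⟩
    x * x + (y - x) * y   ≤⟨ +-monoˡ-≤ _ (*-monoˡ-≤ 0≤x (proj₁ x<y)) ⟩
    x * y + (y - x) * y   ≈⟨ distribʳ y x (y - x) ⟨
    (x + (y - x)) * y     ≈⟨ *-congʳ (trans (+-comm x (y - x)) (x-y+y≈x x y)) ⟩
    y * y                 ∎
    where
    0<y : 0# < y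
    0<y = ≰⇒> λ y≤0 → <⇒≱ x<y (≤-trans y≤0 0≤x)

  0<2 : 0# < 1# + 1#
  0<2 = ≰⇒> λ 2≤0 → <⇒≱ 0<1 (≤-trans (x≤x+y (proj₁ 0<1)) 2≤0)

  ½ : Carrier
  ½ = (1# + 1#) ⁻¹

  halves-sum : ∀ x → x * ½ + x * ½ ≈ x
  halves-sum x = begin-equality
    x * ½ + x * ½             ≈⟨ distribˡ x ½ ½ ⟨
    x * (½ + ½)               ≈⟨ *-congˡ (+-cong (*-identityˡ ½) (*-identityˡ ½)) ⟨
    x * (1# * ½ + 1# * ½)     ≈⟨ *-congˡ (distribʳ ½ 1# 1#) ⟨
    x * ((1# + 1#) * ½) ≈⟨ *-congˡ (*-inverseʳ (1# + 1#) (0<x⇒x≉0 0<2)) ⟩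
    x * 1#              ≈⟨ *-identityʳ x ⟩
    x                   ∎

  -- If i is the infimum, then 2i is again a lower bound.
  halving-limit : ∀ {s : ℕ → Carrier} → (∀ k → s k ≈ s (suc k) + s (suc k)) →
                  ∀ {z} → (∀ k → z ≤ s k) → z ≤ 0#
  halving-limit {s} half {z} z≤s = ≤-trans (i-greatest z z-lower) i≤0
    where
    z-lower : IsLowerBound (λ x → ∃[ k ] x ≈ s k) z
    z-lower x (k , x≈) = ≤-trans (z≤s k) (≤-reflexive (sym x≈))
    inf = infimum (λ x → ∃[ k ] x ≈ s k) (s 0 , 0 , refl) (z , z-lower)
    i = proj₁ inf
    i≤ = proj₁ (proj₂ inf)
    i-greatest = proj₂ (proj₂ inf)
    i≤0 : i ≤ 0#
    i≤0 = linear-≤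
      (i-greatest (i + i) λ x (k , x≈) → begin
        i + i                   ≤⟨ +-mono-≤ (i≤ _ (suc k , refl)) (i≤ _ (suc k , refl)) ⟩
        s (suc k) + s (suc k)   ≈⟨ half k ⟨
        s k                     ≈⟨ x≈ ⟨
        x                       ∎)
      (sym (+-identityˡ (i + i)))

-- Rooms: space in a set of reals for an expanding copy of a half-open interval.

module Rooms
  (em : ∀ {ℓ} → ExcludedMiddle ℓ) (ℝ : CompleteOrderedField) where

  open CompleteOrderedField ℝ hiding (zero)
  open OrderedFieldProperties em ℝ

  -- An expanding map from [0, r) into the part of A to the right of b.
  record Room (A : Pred Carrier 0ℓ) (b r : Carrier) : Set where
    field
      place   : Carrier → Carrier
      into    : ∀ {u} → 0# ≤ u → u < r → A (place u)
      beyond  : ∀ {u} → 0# ≤ u → u < r → b + u ≤ place u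
      expands : ∀ {u v} → 0# ≤ u → u ≤ v → v < r → v + place u ≤ place v + u

  open Room

  room-zero : ∀ {A b} → Room A b 0#
  room-zero .place u = u
  room-zero .into 0≤u u<0 = ⊥-elim (<⇒≱ u<0 0≤u)
  room-zero .beyond 0≤u u<0 = ⊥-elim (<⇒≱ u<0 0≤u)
  room-zero .expands 0≤u u≤v v<0 = ⊥-elim (<⇒≱ v<0 (≤-trans 0≤u u≤v))

  room-weakenˡ : ∀ {A b b′ r} → b′ ≤ b → Room A b r → Room A b′ r
  room-weakenˡ b′≤b R .place = R .place
  room-weakenˡ b′≤b R .into = R .into
  room-weakenˡ b′≤b R .beyond 0≤u u<r =
    ≤-trans (+-monoˡ-≤ _ b′≤b) (R .beyond 0≤u u<r)
  room-weakenˡ b′≤b R .expands = R .expands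

  room-resp-≈ : ∀ {A b r r′} → r ≈ r′ → Room A b r → Room A b r′
  room-resp-≈ {A} {b} {r} {r′} r≈r′ R = record
    { place   = R .place
    ; into    = λ 0≤u u<r′ → R .into 0≤u (to-r u<r′)
    ; beyond  = λ 0≤u u<r′ → R .beyond 0≤u (to-r u<r′)
    ; expands = λ 0≤u u≤v v<r′ → R .expands 0≤u u≤v (to-r v<r′)
    }
    where
    to-r : ∀ {u} → u < r′ → u < r
    to-r u<r′ = <-≤-trans u<r′ (≤-reflexive (sym r≈r′))

  module _ {A : Pred Carrier 0ℓ} {a w b r : Carrier}
           (interval : ∀ {x} → a ≤ x → x < a + w → A x)
           (a+w≤b : a + w ≤ b) (R : Room A b r) where

    private

      -- The decision is an argument so that the proofs below can split on it directly.
      placed : ∀ u → Dec (w ≤ u) → Carrier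
      placed u (no  _) = a + u
      placed u (yes _) = R .place (u - w)

      shifted-nonNeg : ∀ {u} → w ≤ u → 0# ≤ u - w
      shifted-nonNeg = x≤y⇒0≤y-x

      shifted-< : ∀ {u} → u < w + r → u - w < r
      shifted-< {u} u<w+r = linear-< u<w+r (begin-equality
        u - w + (w + r)   ≈⟨ +-assoc (u - w) w r ⟨
        u - w + w + r     ≈⟨ +-congʳ (x-y+y≈x w u) ⟩
        u + r             ≈⟨ +-comm u r ⟩
        r + u             ∎)

      placed-into : ∀ {u} d → 0# ≤ u → u < w + r → A (placed u d)
      placed-into (no w≰u) 0≤u u<w+r =
        interval (x≤x+y 0≤u)
                 (linear-< (≰⇒> w≰u) (solve 3 (λ a u w → a :+ u :+ w := a :+ w :+ u) refl a _ w))
      placed-into (yes w≤u) 0≤u u<w+r =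
        R .into (shifted-nonNeg w≤u) (shifted-< u<w+r)

      placed-beyond : ∀ {u} d → 0# ≤ u → u < w + r → a + u ≤ placed u d
      placed-beyond (no w≰u) 0≤u u<w+r = ≤-refl
      placed-beyond {u} (yes w≤u) 0≤u u<w+r = begin
        a + u               ≈⟨ +-congˡ (trans (+-comm w (u - w)) (x-y+y≈x w u)) ⟨
        a + (w + (u - w))   ≈⟨ +-assoc a w (u - w) ⟨
        a + w + (u - w)     ≤⟨ +-monoˡ-≤ (u - w) a+w≤b ⟩
        b + (u - w)         ≤⟨ R .beyond (shifted-nonNeg w≤u) (shifted-< u<w+r) ⟩
        R .place (u - w)    ∎

      placed-expands : ∀ {u v} d e → 0# ≤ u → u ≤ v → v < w + r →
                       v + placed u d ≤ placed v e + u
      -- Since `u` is still placed at `a + u`, the claim is just that `v` is placed at or beyond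
      -- `a + v`.
      placed-expands {u} {v} (no w≰u) e 0≤u u≤v v<w+r = begin
        v + (a + u)     ≈⟨ solve 3 (λ v a u → v :+ (a :+ u) := a :+ v :+ u) refl v a u ⟩
        a + v + u       ≤⟨ +-monoˡ-≤ u (placed-beyond e (≤-trans 0≤u u≤v) v<w+r) ⟩
        placed v e + u  ∎
      placed-expands (yes w≤u) (no w≰v) 0≤u u≤v v<w+r =
        ⊥-elim (w≰v (≤-trans w≤u u≤v))
      placed-expands {u} {v} (yes w≤u) (yes w≤v) 0≤u u≤v v<w+r = begin
        v + pu                ≈⟨ +-congʳ (x-y+y≈x w v) ⟨
        v - w + w + pu        ≈⟨ solve 3 (λ x y z → x :+ y :+ z := x :+ z :+ y) refl (v - w) w pu ⟩
        v - w + pu + w        ≤⟨ +-monoˡ-≤ w (R .expands (shifted-nonNeg w≤u)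
                                   (+-monoˡ-≤ (- w) u≤v) (shifted-< v<w+r)) ⟩
        pv + (u - w) + w      ≈⟨ +-assoc pv (u - w) w ⟩
        pv + (u - w + w)      ≈⟨ +-congˡ (x-y+y≈x w u) ⟩
        pv + u                ∎
        where
        pu = R .place (u - w)
        pv = R .place (v - w)

    -- Parameters below `w` are laid out in the interval itself, the others are shifted by `w` and
    -- handed to `R`. The jump at `w` goes to the right because `a + w ≤ b`, so it only increases
    -- distances.
    room-glue : Room A a (w + r)
    room-glue .place u = placed u (w ≤? u)
    room-glue .into {u} = placed-into (w ≤? u)
    room-glue .beyond {u} = placed-beyond (w ≤? u)
    room-glue .expands {u} {v} = placed-expands (w ≤? u) (w ≤? v)

-- Open boxes and the core of a region.

module Geometry
  (em : ∀ {ℓ} → ExcludedMiddle ℓ) (ℝ : CompleteOrderedField) where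

  open CompleteOrderedField ℝ hiding (zero)
  open Plane ℝ
  open OrderedFieldProperties em ℝ
  open Rooms em ℝ public

  OpenBox : (l r b t : Carrier) → Region
  OpenBox l r b t (x , y) = (l < x × x < r) × (b < y × y < t)

  square-reflects-< : ∀ {d ε} → 0# ≤ ε → d * d < ε * ε → d < ε
  square-reflects-< 0≤ε dd<εε = ≰⇒> λ ε≤d →
    <⇒≱ dd<εε (*-mono-≤ 0≤ε (≤-trans 0≤ε ε≤d) ε≤d ε≤d)

  IsOpen-∩ : ∀ {S T} → IsOpen S → IsOpen T → IsOpen (S ∩ T)
  IsOpen-∩ openS openT p (p∈S , p∈T)
    with openS p p∈S | openT p p∈T
  ... | ε , 0<ε , ball-ε | δ , 0<δ , ball-δ with ≤-total ε δ
  ...   | inj₁ ε≤δ = ε , 0<ε , λ q q< →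
            ball-ε q q< ,
            ball-δ q (<-≤-trans q< (*-mono-≤ (proj₁ 0<ε) (proj₁ 0<δ) ε≤δ ε≤δ))
  ...   | inj₂ δ≤ε = δ , 0<δ , λ q q< →
            ball-ε q (<-≤-trans q< (*-mono-≤ (proj₁ 0<δ) (proj₁ 0<ε) δ≤ε δ≤ε)) ,
            ball-δ q q<

  private
    -- Here `z` stands for the squared difference in the other coordinate, so that one lemma serves
    -- both axes.
    near : ∀ {x x′ ε z} → 0# ≤ ε → 0# ≤ z →
           (x′ - x) * (x′ - x) + z < ε * ε → x′ - x < ε × x - x′ < ε
    near {x} {x′} {ε} {z} 0≤ε 0≤z lt =
      square-reflects-< 0≤ε (≤-<-trans (x≤x+y 0≤z) lt) ,
      square-reflects-< 0≤ε
        (≤-<-trans (≤-trans (≤-reflexive (*-distance-comm x x′)) (x≤x+y 0≤z)) lt)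

    above : ∀ {l x x′} → x - x′ < x - l → l < x′
    above {l} {x} {x′} lt = linear-< lt (begin-equality
      l + (x - l)           ≈⟨ +-comm l (x - l) ⟩
      x - l + l             ≈⟨ x-y+y≈x l x ⟩
      x                     ≈⟨ x-y+y≈x x′ x ⟨
      x - x′ + x′           ≈⟨ +-comm (x - x′) x′ ⟩
      x′ + (x - x′)         ∎)

    below : ∀ {r x x′} → x′ - x < r - x → x′ < r
    below {r} {x} {x′} lt = linear-< lt (begin-equality
      x′ + (r - x)     ≈⟨ solve 3 (λ u v w → u :+ (v :+ w) := v :+ (u :+ w)) refl x′ r (- x) ⟩
      r + (x′ - x)     ∎)

    near₁ : ∀ {p q ε} → 0# ≤ ε → dist² q p < ε * ε →
            proj₁ q - proj₁ p < ε × proj₁ p - proj₁ q < ε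
    near₁ 0≤ε = near 0≤ε (square-nonNeg _)

    near₂ : ∀ {p q ε} → 0# ≤ ε → dist² q p < ε * ε →
            proj₂ q - proj₂ p < ε × proj₂ p - proj₂ q < ε
    near₂ 0≤ε lt = near 0≤ε (square-nonNeg _)
      (≤-<-trans (≤-reflexive (+-comm _ _)) lt)

  -- A box is the intersection of four open half-planes; in each of them the distance to the
  -- bounding line serves as radius.
  IsOpen-OpenBox : ∀ l r b t → IsOpen (OpenBox l r b t)
  IsOpen-OpenBox l r b t =
    IsOpen-∩ (IsOpen-∩ right-of left-of) (IsOpen-∩ above-of below-of)
    where
    right-of : IsOpen λ (x , y) → l < x
    right-of p l<x = _ , 0<ε , λ q lt → above (proj₂ (near₁ (proj₁ 0<ε) lt))
      where 0<ε = x<y⇒0<y-x l<x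
    left-of : IsOpen λ (x , y) → x < r
    left-of p x<r = _ , 0<ε , λ q lt → below (proj₁ (near₁ (proj₁ 0<ε) lt))
      where 0<ε = x<y⇒0<y-x x<r
    above-of : IsOpen λ (x , y) → b < y
    above-of p b<y = _ , 0<ε , λ q lt → above (proj₂ (near₂ (proj₁ 0<ε) lt))
      where 0<ε = x<y⇒0<y-x b<y
    below-of : IsOpen λ (x , y) → y < t
    below-of p y<t = _ , 0<ε , λ q lt → below (proj₁ (near₂ (proj₁ 0<ε) lt))
      where 0<ε = x<y⇒0<y-x y<t

  -- The strict inequality `c < r` makes the half-open domain of the room contain the whole closed
  -- interval from 0 to `c`.
  Roomy : Region → Carrier → Region
  Roomy S c (x , y) = S (x , y) × ∃[ r ] (c < r × Room (λ t → S (t , y)) x r)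

  -- This is the interior of `Roomy S c`. Written with boxes it is open by construction, and the
  -- interior of a grid cell can enter it in one piece.
  Core : Region → Carrier → Region
  Core S c p = ∃[ l ] ∃[ r ] ∃[ b ] ∃[ t ]
    (OpenBox l r b t p × (∀ q → OpenBox l r b t q → Roomy S c q))

  IsOpen-Core : ∀ S c → IsOpen (Core S c)
  IsOpen-Core S c p (l , r , b , t , p∈box , box⊆)
    with IsOpen-OpenBox l r b t p p∈box
  ... | ε , 0<ε , ball = ε , 0<ε , λ q q< → l , r , b , t , ball q q< , box⊆

  Core⊆Roomy : ∀ {S c} → Core S c ⊆ Roomy S c
  Core⊆Roomy (l , r , b , t , p∈box , box⊆) = box⊆ _ p∈box

-- Extending a containment in the core to the added segment.

module Extension
  (em : ∀ {ℓ} → ExcludedMiddle ℓ) (ℝ : CompleteOrderedField) where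

  open CompleteOrderedField ℝ hiding (zero)
  open Plane ℝ
  open OrderedFieldProperties em ℝ
  open Geometry em ℝ

  -- Expansion without division. For equal arguments it says that `f` does not decrease, and applied
  -- both ways it makes `f` respect equality; so this one condition yields both the `Func` and its
  -- `Expanding` property.
  Stretching : {A B : Pred Carrier 0ℓ} → (∃ A → ∃ B) → Set
  Stretching f = ∀ s t → proj₁ s ≤ proj₁ t →
    proj₁ t + proj₁ (f s) ≤ proj₁ (f t) + proj₁ s

  module _ {A B : Pred Carrier 0ℓ} where

    expanding⇒stretching : (f : Func (SubsetSetoid A) (SubsetSetoid B)) →
                           Expanding f → Stretching (Func.to f)
    expanding⇒stretching f f-expands s t s≤t with em {P = proj₁ s ≈ proj₁ t}
    -- The slope condition is silent about equal arguments; there congruence of `f` is used.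
    ... | yes s≈t = ≤-reflexive (trans (+-comm _ _) (+-cong (Func.cong f s≈t) (sym s≈t)))
    ... | no  s≉t = slope≥1⇒ s<t (f-expands t s s<t)
      where s<t = s≤t , s≉t

    stretching⇒func : {f : ∃ A → ∃ B} → Stretching f →
                      Func (SubsetSetoid A) (SubsetSetoid B)
    stretching⇒func {f} f-stretches = record
      { to   = f
      ; cong = λ {s} {t} s≈t → ≤-antisym (f-mono s t s≈t) (f-mono t s (sym s≈t))
      }
      where
      f-mono : ∀ s t → proj₁ s ≈ proj₁ t → proj₁ (f s) ≤ proj₁ (f t)
      f-mono s t s≈t = linear-≤ (f-stretches s t (≤-reflexive s≈t))
        (trans (solve 3 (λ u v w → u :+ (v :+ w) := v :+ (w :+ u)) refl _ _ _)
               (+-congˡ (+-congʳ s≈t)))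

    stretching⇒expanding : {f : ∃ A → ∃ B} (f-stretches : Stretching f) →
                           Expanding (stretching⇒func {f = f} f-stretches)
    stretching⇒expanding f-stretches s t t<s =
      slope≥1⇐ t<s (f-stretches t s (proj₁ t<s))

  module _ {P S : Region} {x₀ y₀ c : Carrier}
           (rightmost : IsMax (XCoords P) x₀) (p₀ : P (x₀ , y₀))
           (contains : Core S c Contains P) where

    open _Contains_ contains

    private

      P′ : Region
      P′ = P ∪ HorizontalSegment c (x₀ , y₀)

      oldX : ∃ (XCoords P) → ∃ (XCoords (Core S c))
      oldX = Func.to fX

      oldY : ∃ (YCoords P) → ∃ (YCoords (Core S c))
      oldY = Func.to fY

      x₀ₚ : ∃ (XCoords P)
      x₀ₚ = x₀ , y₀ , p₀

      -- The image of the point `(x₀ , y₀)` lies in the core, so its row has room for the segment,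
      -- starting at the image of `x₀`.
      room = Core⊆Roomy (maps-into p₀)
      c<r = proj₁ (proj₂ (proj₂ room))
      open Room (proj₂ (proj₂ (proj₂ room)))

      u<r : ∀ {u} → u ≤ c → u < _
      u<r u≤c = ≤-<-trans u≤c c<r

      -- The two cases exclude each other: an old coordinate is at most `x₀`, a new one is greater.
      -- The left endpoint of the segment therefore counts as old, and the old map keeps its value
      -- there.
      data XView (x : Carrier) : Set where
        old : (t : ∃ (XCoords P)) → proj₁ t ≈ x → XView x
        new : ∀ u → 0# ≤ u → u ≤ c → x₀ < x → x ≈ x₀ + u → XView x

      segmentView : ∀ {x} u → 0# ≤ u → u ≤ c → x ≈ x₀ + u → Dec (u ≤ 0#) → XView x
      segmentView {x} u 0≤u u≤c x≈ (yes u≤0) =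
        old x₀ₚ (trans (sym (+-identityʳ x₀)) (trans (+-congˡ (≤-antisym 0≤u u≤0)) (sym x≈)))
      segmentView {x} u 0≤u u≤c x≈ (no u≰0) =
        new u 0≤u u≤c (linear-< (≰⇒> u≰0) (trans (sym x≈) (sym (+-identityʳ x)))) x≈

      viewX : (s : ∃ (XCoords P′)) → XView (proj₁ s)
      viewX (x , y , inj₁ p) = old (x , y , p) refl
      viewX (x , y , inj₂ (u , 0≤u , u≤c , x≈ , _)) =
        segmentView u 0≤u u≤c x≈ (u ≤? 0#)

      imageX : ∀ {x} → XView x → ∃ (XCoords S)
      imageX (old t _) =
        proj₁ (oldX t) , proj₁ (proj₂ (oldX t)) , proj₁ (Core⊆Roomy (proj₂ (proj₂ (oldX t))))
      imageX (new u 0≤u u≤c _ _) = place u , _ , into 0≤u (u<r u≤c)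

      oldX-stretches = expanding⇒stretching fX fX-expands
      oldY-stretches = expanding⇒stretching fY fY-expands

      imageX-stretches : ∀ {x x′} (v : XView x) (v′ : XView x′) → x ≤ x′ →
                         x′ + proj₁ (imageX v) ≤ proj₁ (imageX v′) + x
      imageX-stretches {x} {x′} (old t t≈x) (old t′ t′≈x′) x≤x′ = begin
        x′ + proj₁ (oldX t)         ≈⟨ +-congʳ t′≈x′ ⟨
        proj₁ t′ + proj₁ (oldX t)   ≤⟨ oldX-stretches t t′ t≤t′ ⟩
        proj₁ (oldX t′) + proj₁ t   ≈⟨ +-congˡ t≈x ⟩
        proj₁ (oldX t′) + x         ∎
        where
        t≤t′ : proj₁ t ≤ proj₁ t′
        t≤t′ = ≤-trans (≤-reflexive t≈x) (≤-trans x≤x′ (≤-reflexive (sym t′≈x′)))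
      -- The estimate passes through `x₀`: the old map stretches from `t` to `x₀`, and `beyond`
      -- contributes the remaining `u`.
      imageX-stretches {x} {x′} (old t t≈x) (new u 0≤u u≤c _ x′≈) x≤x′ = begin
        x′ + ft                ≈⟨ +-congʳ x′≈ ⟩
        x₀ + u + ft            ≈⟨ solve 3 (λ x y z → x :+ y :+ z := x :+ z :+ y) refl x₀ u ft ⟩
        x₀ + ft + u            ≤⟨ +-monoˡ-≤ u (oldX-stretches t x₀ₚ (proj₂ rightmost _ (proj₂ t))) ⟩
        fx₀ + proj₁ t + u      ≈⟨ solve 3 (λ x y z → x :+ y :+ z := x :+ z :+ y) refl fx₀ (proj₁ t) u ⟩
        fx₀ + u + proj₁ t      ≤⟨ +-monoˡ-≤ (proj₁ t) (beyond 0≤u (u<r u≤c)) ⟩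
        place u + proj₁ t      ≈⟨ +-congˡ t≈x ⟩
        place u + x            ∎
        where
        ft = proj₁ (oldX t)
        fx₀ = proj₁ (oldX x₀ₚ)
      -- Impossible, since no old coordinate exceeds `x₀`.
      imageX-stretches {x} {x′} (new _ _ _ x₀<x _) (old t t≈x′) x≤x′ =
        ⊥-elim (<⇒≱ x₀<x (begin
          x         ≤⟨ x≤x′ ⟩
          x′        ≈⟨ t≈x′ ⟨
          proj₁ t   ≤⟨ proj₂ rightmost _ (proj₂ t) ⟩
          x₀        ∎))
      imageX-stretches {x} {x′} (new u 0≤u u≤c _ x≈) (new v _ v≤c _ x′≈) x≤x′ = begin
        x′ + place u           ≈⟨ +-congʳ x′≈ ⟩
        x₀ + v + place u       ≈⟨ +-assoc x₀ v (place u) ⟩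
        x₀ + (v + place u)     ≤⟨ +-monoʳ-≤ x₀ (expands 0≤u u≤v (u<r v≤c)) ⟩
        x₀ + (place v + u)     ≈⟨ solve 3 (λ x y z → x :+ (y :+ z) := y :+ (x :+ z)) refl x₀ (place v) u ⟩
        place v + (x₀ + u)     ≈⟨ +-congˡ x≈ ⟨
        place v + x            ∎
        where
        u≤v : u ≤ v
        u≤v = linear-≤ x≤x′ (begin-equality
          u + x′         ≈⟨ +-congˡ x′≈ ⟩
          u + (x₀ + v)   ≈⟨ solve 3 (λ x y z → x :+ (y :+ z) := z :+ (y :+ x)) refl u x₀ v ⟩
          v + (x₀ + u)   ≈⟨ +-congˡ x≈ ⟨
          v + x          ∎)

      -- The segment lies in the row of `y₀`, so up to equality it brings no new y-coordinate and
      -- the old map can be reused.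
      projectY : (s : ∃ (YCoords P′)) → ∃ (YCoords P)
      projectY (y , x , inj₁ p) = y , x , p
      projectY (y , x , inj₂ _) = y₀ , x₀ , p₀

      projectY-≈ : ∀ s → proj₁ (projectY s) ≈ proj₁ s
      projectY-≈ (y , x , inj₁ p) = refl
      projectY-≈ (y , x , inj₂ (_ , _ , _ , _ , y≈)) = sym y≈

      newX : ∃ (XCoords P′) → ∃ (XCoords S)
      newX s = imageX (viewX s)

      newY : ∃ (YCoords P′) → ∃ (YCoords S)
      newY s = proj₁ t , proj₁ (proj₂ t) , proj₁ (Core⊆Roomy (proj₂ (proj₂ t)))
        where t = oldY (projectY s)

      newX-stretches : Stretching newX
      newX-stretches s t = imageX-stretches (viewX s) (viewX t)

      newY-stretches : Stretching newY
      newY-stretches s t s≤t = begin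
        proj₁ t + fs                    ≈⟨ +-congʳ (projectY-≈ t) ⟨
        proj₁ (projectY t) + fs         ≤⟨ oldY-stretches (projectY s) (projectY t)
                                             (≤-trans (≤-reflexive (projectY-≈ s))
                                               (≤-trans s≤t (≤-reflexive (sym (projectY-≈ t))))) ⟩
        ft + proj₁ (projectY s)         ≈⟨ +-congˡ (projectY-≈ s) ⟩
        ft + proj₁ s                    ∎
        where
        fs = proj₁ (oldY (projectY s))
        ft = proj₁ (oldY (projectY t))

      segment-into : ∀ {x} u 0≤u u≤c (x≈ : x ≈ x₀ + u) d →
        S ( proj₁ (imageX (segmentView u 0≤u u≤c x≈ d))
          , proj₁ (oldY (y₀ , x₀ , p₀)))
      segment-into u 0≤u u≤c x≈ (yes _) = proj₁ room
      segment-into u 0≤u u≤c x≈ (no _) = into 0≤u (u<r u≤c)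

      new-maps-into : ∀ {x y} (p : P′ (x , y)) →
        S (proj₁ (newX (x , y , p)) , proj₁ (newY (y , x , p)))
      new-maps-into (inj₁ p) = proj₁ (Core⊆Roomy (maps-into p))
      new-maps-into (inj₂ (u , 0≤u , u≤c , x≈ , _)) = segment-into u 0≤u u≤c x≈ (u ≤? 0#)

    extend : S Contains P′
    extend = record
      { fX         = stretching⇒func {f = newX} newX-stretches
      ; fY         = stretching⇒func {f = newY} newY-stretches
      ; fX-expands = stretching⇒expanding {f = newX} newX-stretches
      ; fY-expands = stretching⇒expanding {f = newY} newY-stretches
      ; maps-into  = new-maps-into
      }

-- Finite sums, and merging covers into a single sequence.

module Covering
  (em : ∀ {ℓ} → ExcludedMiddle ℓ) (ℝ : CompleteOrderedField) where

  open CompleteOrderedField ℝ hiding (zero)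
  open Plane ℝ
  open OrderedFieldProperties em ℝ
  open import Algebra.Properties.CommutativeMonoid.Sum +-commutativeMonoid
    using (sum-syntax)

  private variable A B : Set

  Σₗ : List A → (A → Carrier) → Carrier
  Σₗ xs f = foldr (λ x s → f x + s) 0# xs

  Σₗ-++ : ∀ (xs ys : List A) f → Σₗ (xs ++ ys) f ≈ Σₗ xs f + Σₗ ys f
  Σₗ-++ [] ys f = sym (+-identityˡ _)
  Σₗ-++ (x ∷ xs) ys f = trans (+-congˡ (Σₗ-++ xs ys f)) (sym (+-assoc _ _ _))

  Σₗ-concatMap : ∀ (g : A → List B) xs f →
                 Σₗ (concatMap g xs) f ≈ Σₗ xs (λ x → Σₗ (g x) f)
  Σₗ-concatMap g [] f = refl
  Σₗ-concatMap g (x ∷ xs) f =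
    trans (Σₗ-++ (g x) (concatMap g xs) f) (+-congˡ (Σₗ-concatMap g xs f))

  Σₗ-cong : ∀ (xs : List A) {f g} → (∀ x → f x ≈ g x) → Σₗ xs f ≈ Σₗ xs g
  Σₗ-cong [] f≈g = refl
  Σₗ-cong (x ∷ xs) f≈g = +-cong (f≈g x) (Σₗ-cong xs f≈g)

  Σₗ-cong-All : ∀ {xs : List A} {f g} → All (λ x → f x ≈ g x) xs →
                Σₗ xs f ≈ Σₗ xs g
  Σₗ-cong-All [] = refl
  Σₗ-cong-All (f≈g ∷ fs≈gs) = +-cong f≈g (Σₗ-cong-All fs≈gs)

  Σₗ-mono : ∀ (xs : List A) {f g} → (∀ x → f x ≤ g x) → Σₗ xs f ≤ Σₗ xs g
  Σₗ-mono [] f≤g = ≤-refl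
  Σₗ-mono (x ∷ xs) f≤g = +-mono-≤ (f≤g x) (Σₗ-mono xs f≤g)

  Σₗ-+ : ∀ (xs : List A) f g → Σₗ xs (λ x → f x + g x) ≈ Σₗ xs f + Σₗ xs g
  Σₗ-+ [] f g = sym (+-identityˡ 0#)
  Σₗ-+ (x ∷ xs) f g = trans (+-congˡ (Σₗ-+ xs f g))
    (solve 4 (λ a b c d → a :+ b :+ (c :+ d) := a :+ c :+ (b :+ d)) refl
      (f x) (g x) (Σₗ xs f) (Σₗ xs g))

  Σₗ-*ˡ : ∀ (xs : List A) z f → Σₗ xs (λ x → z * f x) ≈ z * Σₗ xs f
  Σₗ-*ˡ [] z f = sym (zeroʳ z)
  Σₗ-*ˡ (x ∷ xs) z f = trans (+-congˡ (Σₗ-*ˡ xs z f)) (sym (distribˡ z _ _))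

  -- The sum splits off its first term, so the induction shifts both sequences.
  ∑-telescope : ∀ (s g : ℕ → Carrier) → (∀ j → s j + g j ≈ s (suc j)) →
                ∀ K → s 0 + ∑[ j < K ] g (toℕ j) ≈ s K
  ∑-telescope s g step zero = +-identityʳ (s 0)
  ∑-telescope s g step (suc K) = begin-equality
    s 0 + (g 0 + rest)    ≈⟨ +-assoc (s 0) (g 0) rest ⟨
    s 0 + g 0 + rest      ≈⟨ +-congʳ (step 0) ⟩
    s 1 + rest            ≈⟨ ∑-telescope (s ∘ suc) (g ∘ suc) (step ∘ suc) K ⟩
    s (suc K)             ∎
    where rest = ∑[ j < K ] g (suc (toℕ j))

  total : List Rectangle → Carrier
  total Rs = Σₗ Rs area

  ∈-some : List Rectangle → Region
  ∈-some Rs p = Any (λ R → ⟦ R ⟧ p) Rs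

  -- Merges a cover with countably many finite lists. The last list is a queue; whenever it is
  -- empty, the next rectangle of `R` is emitted and the next list of `G` becomes the queue. Each
  -- index thus receives a rectangle even if all the lists are empty.
  interleave : (ℕ → Rectangle) → (ℕ → List Rectangle) → List Rectangle →
               ℕ → Rectangle
  interleave R G []       zero    = R 0
  interleave R G []       (suc i) = interleave (R ∘ suc) (G ∘ suc) (G 0) i
  interleave R G (r ∷ rs) zero    = r
  interleave R G (r ∷ rs) (suc i) = interleave R G rs i

  interleave-covers-list : ∀ R G rs {p} → ∈-some rs p →
                           ∃[ i ] ⟦ interleave R G rs i ⟧ p
  interleave-covers-list R G (r ∷ rs) (here p∈r) = 0 , p∈r
  interleave-covers-list R G (r ∷ rs) (there p∈rs)
    with interleave-covers-list R G rs p∈rs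
  ... | i , p∈ = suc i , p∈

  -- Passing the queue and one entry of `R` leads to the state of the recursive call; this is the
  -- common step of the inductions on `j` below.
  interleave-skip : ∀ R G rs {p} →
    ∃[ i ] ⟦ interleave (R ∘ suc) (G ∘ suc) (G 0) i ⟧ p →
    ∃[ i ] ⟦ interleave R G rs i ⟧ p
  interleave-skip R G [] (i , p∈) = suc i , p∈
  interleave-skip R G (r ∷ rs) q with interleave-skip R G rs q
  ... | i , p∈ = suc i , p∈

  interleave-covers-stream : ∀ R G rs j {p} → ∈-some (G j) p →
                             ∃[ i ] ⟦ interleave R G rs i ⟧ p
  interleave-covers-stream R G rs zero p∈ =
    interleave-skip R G rs (interleave-covers-list _ _ (G 0) p∈)
  interleave-covers-stream R G rs (suc j) p∈ =
    interleave-skip R G rs (interleave-covers-stream _ _ (G 0) j p∈)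

  interleave-covers-sequence : ∀ R G rs j {p} → ⟦ R j ⟧ p →
                               ∃[ i ] ⟦ interleave R G rs i ⟧ p
  interleave-covers-sequence R G [] zero p∈ = 0 , p∈
  interleave-covers-sequence R G (r ∷ rs) zero p∈
    with interleave-covers-sequence R G rs zero p∈
  ... | i , p∈′ = suc i , p∈′
  interleave-covers-sequence R G rs (suc j) p∈ =
    interleave-skip R G rs (interleave-covers-sequence _ _ (G 0) j p∈)

  area-nonNeg : ∀ R → 0# ≤ area R
  area-nonNeg R = *-nonNeg (x≤y⇒0≤y-x (Rectangle.left≤right R))
                           (x≤y⇒0≤y-x (Rectangle.bottom≤top R))

  total-nonNeg : ∀ Rs → 0# ≤ total Rs
  total-nonNeg [] = ≤-refl
  total-nonNeg (R ∷ Rs) =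
    ≤-trans (area-nonNeg R) (x≤x+y (total-nonNeg Rs))

  partialArea : (ℕ → Rectangle) → ℕ → Carrier
  partialArea R k = ∑[ i < k ] area (R (toℕ i))

  -- `K` counts the entries of `R` emitted so far, and as many lists have been loaded. The last of
  -- them may be emitted only in part, but areas are nonnegative, so it may be counted in full.
  interleave-partialArea : ∀ R G rs k → ∃[ K ]
    partialArea (interleave R G rs) k
      ≤ total rs + (partialArea R K + ∑[ j < K ] total (G (toℕ j)))
  interleave-partialArea R G rs zero = 0 , (begin
    0#                      ≤⟨ total-nonNeg rs ⟩
    total rs                ≈⟨ +-identityʳ (total rs) ⟨
    total rs + 0#           ≈⟨ +-congˡ (+-identityʳ 0#) ⟨
    total rs + (0# + 0#)    ∎)
  interleave-partialArea R G [] (suc k)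
    with interleave-partialArea (R ∘ suc) (G ∘ suc) (G 0) k
  ... | K , le = suc K , (begin
    a + partialArea (interleave (R ∘ suc) (G ∘ suc) (G 0)) k
      ≤⟨ +-monoʳ-≤ a le ⟩
    a + (t + (u + v))
      ≈⟨ solve 4 (λ a t u v → a :+ (t :+ (u :+ v)) := a :+ u :+ (t :+ v)) refl a t u v ⟩
    a + u + (t + v)
      ≈⟨ +-identityˡ _ ⟨
    0# + (a + u + (t + v)) ∎)
    where
    a = area (R 0)
    t = total (G 0)
    u = partialArea (R ∘ suc) K
    v = ∑[ j < K ] total (G (suc (toℕ j)))
  interleave-partialArea R G (r ∷ rs) (suc k)
    with interleave-partialArea R G rs k
  ... | K , le = K , ≤-trans (+-monoʳ-≤ (area r) le)
                             (≤-reflexive (sym (+-assoc _ _ _)))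

  -- The merged sequence covers `S`, and its partial sums are bounded by `a + b`. The total area of
  -- this cover is not computed: completeness provides it, and it is at most `a + b`.
  μ₂≤ : ∀ {S finite R a} {G : ℕ → List Rectangle} {rs b} →
        HasTotalArea R a →
        (∀ K → total rs + ∑[ j < K ] total (G (toℕ j)) ≤ b) →
        (∀ {p} → S p →
          (∃[ i ] ⟦ R i ⟧ p) ⊎ ∈-some rs p ⊎ (∃[ j ] ∈-some (G j) p)) →
        μ₂ S finite ≤ a + b
  μ₂≤ {S} {finite} {R} {a} {G} {rs} {b} R-total G-total S-covered = begin
    μ₂ S finite   ≤⟨ proj₁ (μ₂-isInf S finite) s (cover , covers , s-isSup) ⟩
    s             ≤⟨ proj₂ s-isSup (a + b) bounded ⟩
    a + b         ∎
    where
    cover = interleave R G rs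

    covers : Covers cover S
    covers p∈S with S-covered p∈S
    ... | inj₁ (i , p∈) = interleave-covers-sequence R G rs i p∈
    ... | inj₂ (inj₁ p∈) = interleave-covers-list R G rs p∈
    ... | inj₂ (inj₂ (j , p∈)) = interleave-covers-stream R G rs j p∈

    PartialSum : Pred Carrier 0ℓ
    PartialSum t = ∃[ k ] t ≈ partialArea cover k

    bounded : IsUpperBound PartialSum (a + b)
    bounded t (k , t≈) with interleave-partialArea R G rs k
    ... | K , le = begin
      t                     ≈⟨ t≈ ⟩
      partialArea cover k   ≤⟨ le ⟩
      x + (y + z)           ≈⟨ solve 3 (λ x y z → x :+ (y :+ z) := y :+ (x :+ z)) refl x y z ⟩
      y + (x + z)           ≤⟨ +-mono-≤ (proj₁ R-total y (K , refl)) (G-total K) ⟩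
      a + b                 ∎
      where
      x = total rs
      y = partialArea R K
      z = ∑[ j < K ] total (G (toℕ j))

    sup = complete PartialSum (0# , 0 , refl) (a + b , bounded)
    s = proj₁ sup
    s-isSup = proj₂ sup

-- Intervals, boxes and their subdivision.

module Grid
  (em : ∀ {ℓ} → ExcludedMiddle ℓ) (ℝ : CompleteOrderedField) where

  open CompleteOrderedField ℝ hiding (zero)
  open Plane ℝ
  open OrderedFieldProperties em ℝ
  open Geometry em ℝ
  open Covering em ℝ
  open import Algebra.Properties.CommutativeMonoid.Sum +-commutativeMonoid
    using (sum-syntax)

  Interval : Carrier → Carrier → Pred Carrier 0ℓ
  Interval a w x = a ≤ x × x ≤ a + w

  box : ∀ (a : Carrier) {w} → 0# ≤ w → (b : Carrier) → ∀ {v} → 0# ≤ v → Rectangle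
  box a {w} 0≤w b {v} 0≤v = record
    { left = a ; right = a + w ; bottom = b ; top = b + v
    ; left≤right = x≤x+y 0≤w ; bottom≤top = x≤x+y 0≤v }

  area-box : ∀ a {w} (0≤w : 0# ≤ w) b {v} (0≤v : 0# ≤ v) →
             area (box a 0≤w b 0≤v) ≈ w * v
  area-box a {w} 0≤w b {v} 0≤v = *-cong (length≈ a w) (length≈ b v)
    where
    length≈ : ∀ a w → a + w - a ≈ w
    length≈ a w = trans (+-congʳ (+-comm a w)) (x+y-y≈x a w)

  first-half : ∀ {a w v x} → 0# ≤ w → v ≈ w + w → Interval a w x → Interval a v x
  first-half {a} {w} {v} {x} 0≤w v≈ (a≤x , x≤) = a≤x , (begin
    x             ≤⟨ x≤ ⟩
    a + w         ≤⟨ +-monoʳ-≤ a (x≤x+y 0≤w) ⟩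
    a + (w + w)   ≈⟨ +-congˡ v≈ ⟨
    a + v         ∎)

  second-half : ∀ {a w v x} → 0# ≤ w → v ≈ w + w → Interval (a + w) w x → Interval a v x
  second-half {a} {w} {v} {x} 0≤w v≈ (a+w≤x , x≤) = ≤-trans (x≤x+y 0≤w) a+w≤x , (begin
    x             ≤⟨ x≤ ⟩
    a + w + w     ≈⟨ +-assoc a w w ⟩
    a + (w + w)   ≈⟨ +-congˡ v≈ ⟨
    a + v         ∎)

  which-half : ∀ {a w v x} → v ≈ w + w → Interval a v x →
               Interval a w x ⊎ Interval (a + w) w x
  which-half {a} {w} {v} {x} v≈ (a≤x , x≤) with ≤-total x (a + w)
  ... | inj₁ x≤a+w = inj₁ (a≤x , x≤a+w)
  ... | inj₂ a+w≤x = inj₂ (a+w≤x , (begin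
    x             ≤⟨ x≤ ⟩
    a + v         ≈⟨ +-congˡ v≈ ⟩
    a + (w + w)   ≈⟨ +-assoc a w w ⟨
    a + w + w     ∎))

  interval-distance-≤ : ∀ {a w x y} → Interval a w x → Interval a w y → y ≤ x →
                        (x - y) * (x - y) ≤ w * w
  interval-distance-≤ {a} {w} {x} {y} (_ , x≤) (a≤y , _) y≤x =
    *-mono-≤ 0≤d (≤-trans 0≤d d≤w) d≤w d≤w
    where
    0≤d = x≤y⇒0≤y-x y≤x
    d≤w : x - y ≤ w
    d≤w = +-cancelʳ-≤ y (begin
      x - y + y   ≈⟨ x-y+y≈x y x ⟩
      x           ≤⟨ x≤ ⟩
      a + w       ≤⟨ +-monoˡ-≤ w a≤y ⟩
      y + w       ≈⟨ +-comm y w ⟩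
      w + y       ∎)

  interval-distance : ∀ {a w x y} → Interval a w x → Interval a w y →
                      (x - y) * (x - y) ≤ w * w
  interval-distance {x = x} {y} x∈ y∈ with ≤-total y x
  ... | inj₁ y≤x = interval-distance-≤ x∈ y∈ y≤x
  ... | inj₂ x≤y =
    ≤-trans (≤-reflexive (*-distance-comm x y)) (interval-distance-≤ y∈ x∈ x≤y)

  χ : {P : Set} → Dec P → Carrier → Carrier
  χ (yes _) x = x
  χ (no  _) x = 0#

  χ-true : {P : Set} (d : Dec P) → P → ∀ x → χ d x ≈ x
  χ-true (yes _) p x = refl
  χ-true (no ¬p) p x = ⊥-elim (¬p p)

  χ≤ : {P : Set} (d : Dec P) {x : Carrier} → 0# ≤ x → χ d x ≤ x
  χ≤ (yes _) 0≤x = ≤-refl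
  χ≤ (no  _) 0≤x = 0≤x

  χ-cong : {P : Set} (d : Dec P) {x y : Carrier} → x ≈ y → χ d x ≈ χ d y
  χ-cong (yes _) x≈y = x≈y
  χ-cong (no  _) x≈y = refl

  only-if : {P : Set} → Dec P → Rectangle → List Rectangle
  only-if (yes _) R = R ∷ []
  only-if (no  _) R = []

  total-only-if : {P : Set} (d : Dec P) (R : Rectangle) → total (only-if d R) ≈ χ d (area R)
  total-only-if (yes _) R = +-identityʳ (area R)
  total-only-if (no  _) R = refl

  ∈-only-if : {P : Set} (d : Dec P) → P → ∀ {R p} → ⟦ R ⟧ p → ∈-some (only-if d R) p
  ∈-only-if (yes _) _ p∈R = here p∈R
  ∈-only-if (no ¬P) P p∈R = ⊥-elim (¬P P)

  -- Keeps the left-to-right order of a row of cells, in the inductive form in which `row-room`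
  -- consumes it. Inequalities are enough there, as gaps only help expansion.
  data Spaced (w : Carrier) : Carrier → List Carrier → Set where
    []  : ∀ {s} → Spaced w s []
    _∷_ : ∀ {s a l} → s ≤ a → Spaced w (a + w) l → Spaced w s (a ∷ l)

  spaced-weaken : ∀ {w s t l} → s ≤ t → Spaced w t l → Spaced w s l
  spaced-weaken s≤t []        = []
  spaced-weaken s≤t (t≤a ∷ l) = ≤-trans s≤t t≤a ∷ l

  halves : Carrier → Carrier → List Carrier
  halves w a = a ∷ a + w ∷ []

  spaced-halves : ∀ {w v s l} → v ≈ w + w → Spaced v s l →
                  Spaced w s (concatMap (halves w) l)
  spaced-halves v≈ [] = []
  spaced-halves {w} {v} v≈ (_∷_ {a = a} s≤a l) =
    s≤a ∷ (≤-refl ∷ spaced-weaken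
      (≤-reflexive (trans (+-assoc a w w) (+-congˡ (sym v≈))))
      (spaced-halves v≈ l))

  quarters : Carrier → Point → List Point
  quarters w (a , b) =
    (a , b) ∷ (a + w , b) ∷ (a , b + w) ∷ (a + w , b + w) ∷ []

  -- Dyadic grids of the square.

  module _ {n : Carrier} (0≤n : 0# ≤ n) where

    h : ℕ → Carrier
    h zero    = n
    h (suc k) = h k * ½

    h-half : ∀ k → h k ≈ h (suc k) + h (suc k)
    h-half k = sym (halves-sum (h k))

    0≤h : ∀ k → 0# ≤ h k
    0≤h zero    = 0≤n
    0≤h (suc k) = *-nonNeg (0≤h k) (⁻¹-nonNeg 0<2)

    -- Twice the mesh bounds the diameter of a cell without a square root. If it never fell below
    -- `ε`, then `halving-limit` would give `ε ≤ 0#`.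
    h-small : ∀ {ε} → 0# < ε → ∀ k → ∃[ j ] h (j ℕ.+ k) + h (j ℕ.+ k) < ε
    h-small {ε} 0<ε k with em {P = ∃[ j ] h (j ℕ.+ k) + h (j ℕ.+ k) < ε}
    ... | yes found = found
    ... | no  none  = ⊥-elim (<⇒≱ 0<ε (halving-limit
      (λ j → +-cong (h-half (j ℕ.+ k)) (h-half (j ℕ.+ k))) ε≤))
      where
      ε≤ : ∀ j → ε ≤ h (j ℕ.+ k) + h (j ℕ.+ k)
      ε≤ j with ε ≤? h (j ℕ.+ k) + h (j ℕ.+ k)
      ... | yes le = le
      ... | no ¬le = ⊥-elim (none (j , ≰⇒> ¬le))

    lefts : ℕ → List Carrier
    lefts zero    = 0# ∷ []
    lefts (suc k) = concatMap (halves (h (suc k))) (lefts k)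

    spaced-lefts : ∀ k → Spaced (h k) 0# (lefts k)
    spaced-lefts zero    = ≤-refl ∷ []
    spaced-lefts (suc k) = spaced-halves (h-half k) (spaced-lefts k)

    Σ-lefts : ∀ k → Σₗ (lefts k) (λ _ → h k) ≈ n
    Σ-lefts zero    = +-identityʳ n
    Σ-lefts (suc k) = begin-equality
      Σₗ (concatMap (halves w) (lefts k)) (λ _ → w)
        ≈⟨ Σₗ-concatMap (halves w) (lefts k) _ ⟩
      Σₗ (lefts k) (λ _ → w + (w + 0#))
        ≈⟨ Σₗ-cong (lefts k) (λ _ → trans (+-congˡ (+-identityʳ w)) (sym (h-half k))) ⟩
      Σₗ (lefts k) (λ _ → h k)
        ≈⟨ Σ-lefts k ⟩
      n ∎
      where w = h (suc k)

    cell : ℕ → Point → Rectangle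
    cell k (a , b) = box a (0≤h k) b (0≤h k)

    area-cell : ∀ k C → area (cell k C) ≈ h k * h k
    area-cell k (a , b) = area-box a (0≤h k) b (0≤h k)

    cells : ℕ → List Point
    cells zero    = (0# , 0#) ∷ []
    cells (suc k) = concatMap (quarters (h (suc k))) (cells k)

    -- Links two descriptions of one grid: `cells` is built as a quadtree, for comparing cells with
    -- their parents, while `lefts` gives the rows for the estimate of the leftover area.
    ∈-cells : ∀ k {a b} → (a , b) ∈ cells k → a ∈ lefts k × b ∈ lefts k
    ∈-cells zero (here ≡.refl) = here ≡.refl , here ≡.refl
    ∈-cells (suc k) C∈ with find (concatMap⁻ (quarters (h (suc k))) {xs = cells k} C∈)
    ... | (a , b) , ab∈ , C∈q with ∈-cells k ab∈
    ...   | a∈ , b∈ = go C∈q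
      where
      w = h (suc k)
      fst : ∀ {a} → a ∈ lefts k → a ∈ lefts (suc k)
      fst a∈ = concatMap⁺ (halves w) (lose a∈ (here ≡.refl))
      snd : ∀ {a} → a ∈ lefts k → a + w ∈ lefts (suc k)
      snd a∈ = concatMap⁺ (halves w) (lose a∈ (there (here ≡.refl)))
      go : ∀ {c d} → (c , d) ∈ quarters w (a , b) → c ∈ lefts (suc k) × d ∈ lefts (suc k)
      go (here ≡.refl)                         = fst a∈ , fst b∈
      go (there (here ≡.refl))                 = snd a∈ , fst b∈
      go (there (there (here ≡.refl)))         = fst a∈ , snd b∈
      go (there (there (there (here ≡.refl)))) = snd a∈ , snd b∈

    locate : ∀ k {p} → Square n p → Any (λ C → ⟦ cell k C ⟧ p) (cells k)
    locate zero ((0≤x , x≤n) , (0≤y , y≤n)) = here ((0≤x , x≤0+n x≤n) , (0≤y , x≤0+n y≤n))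
      where
      x≤0+n : ∀ {x} → x ≤ n → x ≤ 0# + n
      x≤0+n x≤n = ≤-trans x≤n (≤-reflexive (sym (+-identityˡ n)))
    locate (suc k) {p} p∈ =
      concatMap⁺ (quarters (h (suc k))) (Any.map quarter (locate k p∈))
      where
      quarter : ∀ {C} → ⟦ cell k C ⟧ p →
                Any (λ D → ⟦ cell (suc k) D ⟧ p) (quarters (h (suc k)) C)
      quarter (x∈ , y∈) with which-half (h-half k) x∈ | which-half (h-half k) y∈
      ... | inj₁ x∈ | inj₁ y∈ = here (x∈ , y∈)
      ... | inj₂ x∈ | inj₁ y∈ = there (here (x∈ , y∈))
      ... | inj₁ x∈ | inj₂ y∈ = there (there (here (x∈ , y∈)))
      ... | inj₂ x∈ | inj₂ y∈ = there (there (there (here (x∈ , y∈))))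

    quarters-within : ∀ k C →
      All (λ D → ⟦ cell (suc k) D ⟧ ⊆ ⟦ cell k C ⟧) (quarters (h (suc k)) C)
    quarters-within k C =
      (λ (x∈ , y∈) → fst x∈ , fst y∈) ∷ (λ (x∈ , y∈) → snd x∈ , fst y∈) ∷
      (λ (x∈ , y∈) → fst x∈ , snd y∈) ∷ (λ (x∈ , y∈) → snd x∈ , snd y∈) ∷ []
      where
      fst : ∀ {a x} → Interval a (h (suc k)) x → Interval a (h k) x
      fst = first-half (0≤h (suc k)) (h-half k)
      snd : ∀ {a x} → Interval (a + h (suc k)) (h (suc k)) x → Interval a (h k) x
      snd = second-half (0≤h (suc k)) (h-half k)

    Σ-quarters : ∀ k C → Σₗ (quarters (h (suc k)) C) (λ _ → h (suc k) * h (suc k)) ≈ h k * h k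
    Σ-quarters k C = begin-equality
      w * w + (w * w + (w * w + (w * w + 0#)))
        ≈⟨ +-congˡ (+-congˡ (+-congˡ (+-identityʳ (w * w)))) ⟩
      w * w + (w * w + (w * w + w * w))
        ≈⟨ solve 1 (λ w → w :* w :+ (w :* w :+ (w :* w :+ w :* w)) := (w :+ w) :* (w :+ w)) refl w ⟩
      (w + w) * (w + w)
        ≈⟨ *-cong (h-half k) (h-half k) ⟨
      h k * h k ∎
      where w = h (suc k)

    Σ-cells : ∀ k → Σₗ (cells k) (λ _ → h k * h k) ≈ n * n
    Σ-cells zero    = +-identityʳ (n * n)
    Σ-cells (suc k) = begin-equality
      Σₗ (cells (suc k)) (λ _ → w * w)
        ≈⟨ Σₗ-concatMap (quarters w) (cells k) _ ⟩
      Σₗ (cells k) (λ C → Σₗ (quarters w C) (λ _ → w * w))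
        ≈⟨ Σₗ-cong (cells k) (Σ-quarters k) ⟩
      Σₗ (cells k) (λ _ → h k * h k)
        ≈⟨ Σ-cells k ⟩
      n * n ∎
      where w = h (suc k)

    -- Grid cells contained in the region, and their total area.

    module _ (S : Region) where

      Inside : ℕ → Point → Set
      Inside k C = ⟦ cell k C ⟧ ⊆ S

      inside? : ∀ k C → Dec (Inside k C)
      inside? k C = em

      innerArea : ℕ → Carrier
      innerArea k = Σₗ (cells k) λ C → χ (inside? k C) (h k * h k)

      innerArea≤n² : ∀ k → innerArea k ≤ n * n
      innerArea≤n² k = begin
        innerArea k
          ≤⟨ Σₗ-mono (cells k) (λ C → χ≤ (inside? k C) (*-nonNeg (0≤h k) (0≤h k))) ⟩
        Σₗ (cells k) (λ _ → h k * h k)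
          ≈⟨ Σ-cells k ⟩
        n * n ∎

      insideCell : ℕ → Point → List Rectangle
      insideCell k C = only-if (inside? k C) (cell k C)

      freshIn : ∀ k C → Dec (Inside k C) → List Rectangle
      freshIn k C (yes _) = []
      freshIn k C (no  _) = concatMap (insideCell (suc k)) (quarters (h (suc k)) C)

      -- The inner cells of level k + 1 whose parent cell is not inner.
      fresh : ℕ → List Rectangle
      fresh k = concatMap (λ C → freshIn k C (inside? k C)) (cells k)

      -- The four quarters of an inner cell are inner and share out its area, and none is fresh. If
      -- the parent is not inner, all its inner quarters are fresh.
      freshIn-area : ∀ k C (d : Dec (Inside k C)) →
        χ d (h k * h k) + total (freshIn k C d)
          ≈ Σₗ (quarters (h (suc k)) C) (λ D → χ (inside? (suc k) D) (h (suc k) * h (suc k)))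
      freshIn-area k C (yes inside) = begin-equality
        h k * h k + 0#
          ≈⟨ +-identityʳ _ ⟩
        h k * h k
          ≈⟨ Σ-quarters k C ⟨
        Σₗ (quarters w C) (λ _ → w * w)
          ≈⟨ Σₗ-cong-All (All.map
               (λ {D} D⊆C → χ-true (inside? (suc k) D) (λ p∈ → inside (D⊆C p∈)) (w * w))
               (quarters-within k C)) ⟨
        Σₗ (quarters w C) (λ D → χ (inside? (suc k) D) (w * w)) ∎
        where w = h (suc k)
      freshIn-area k C (no _) = begin-equality
        0# + total (concatMap (insideCell (suc k)) (quarters w C))
          ≈⟨ +-identityˡ _ ⟩
        total (concatMap (insideCell (suc k)) (quarters w C))
          ≈⟨ Σₗ-concatMap (insideCell (suc k)) (quarters w C) area ⟩
        Σₗ (quarters w C) (λ D → total (insideCell (suc k) D))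
          ≈⟨ Σₗ-cong (quarters w C) (λ D → trans
               (total-only-if (inside? (suc k) D) (cell (suc k) D))
               (χ-cong (inside? (suc k) D) (area-cell (suc k) D))) ⟩
        Σₗ (quarters w C) (λ D → χ (inside? (suc k) D) (w * w)) ∎
        where w = h (suc k)

      -- Makes the areas of the fresh cells the increments of a bounded sequence, so that they
      -- telescope.
      innerArea-suc : ∀ k → innerArea k + total (fresh k) ≈ innerArea (suc k)
      innerArea-suc k = begin-equality
        innerArea k + total (fresh k)
          ≈⟨ +-congˡ (Σₗ-concatMap (λ C → freshIn k C (inside? k C)) (cells k) area) ⟩
        innerArea k + Σₗ (cells k) (λ C → total (freshIn k C (inside? k C)))
          ≈⟨ Σₗ-+ (cells k) _ _ ⟨
        Σₗ (cells k) (λ C → χ (inside? k C) (h k * h k) + total (freshIn k C (inside? k C)))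
          ≈⟨ Σₗ-cong (cells k) (λ C → freshIn-area k C (inside? k C)) ⟩
        Σₗ (cells k) (λ C → Σₗ (quarters w C) (λ D → χ (inside? (suc k) D) (w * w)))
          ≈⟨ Σₗ-concatMap (quarters w) (cells k) _ ⟨
        innerArea (suc k) ∎
        where w = h (suc k)

      innerArea-mono : ∀ j k → innerArea k ≤ innerArea (j ℕ.+ k)
      innerArea-mono zero    k = ≤-refl
      innerArea-mono (suc j) k = begin
        innerArea k
          ≤⟨ innerArea-mono j k ⟩
        innerArea (j ℕ.+ k)
          ≤⟨ x≤x+y (total-nonNeg (fresh (j ℕ.+ k))) ⟩
        innerArea (j ℕ.+ k) + total (fresh (j ℕ.+ k))
          ≈⟨ innerArea-suc (j ℕ.+ k) ⟩
        innerArea (suc j ℕ.+ k) ∎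

      InsideAt : ℕ → Point → Point → Set
      InsideAt k p C = Inside k C × ⟦ cell k C ⟧ p

      freshIn-covers : ∀ k {p C} (d : Dec (Inside k C)) → ¬ InsideAt k p C →
        Any (InsideAt (suc k) p) (quarters (h (suc k)) C) → ∈-some (freshIn k C d) p
      freshIn-covers k {C = C} (yes inside) ¬at at =
        ⊥-elim (¬at (inside , All.lookupWith (λ D⊆C (_ , p∈D) → D⊆C p∈D) (quarters-within k C) at))
      freshIn-covers k (no _) ¬at at = concatMap⁺ (insideCell (suc k))
        (Any.map (λ {D} (inside , p∈D) → ∈-only-if (inside? (suc k) D) inside p∈D) at)

      -- Passes to coarser levels as long as some inner cell contains `p`. Where this stops, the
      -- parent of the inner cell last found is not inner, so that cell is fresh. The case
      -- distinction concerns all cells of a level, because a point on an edge lies in several.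
      descend : ∀ j k {p} → Any (InsideAt (j ℕ.+ k) p) (cells (j ℕ.+ k)) →
        Any (InsideAt k p) (cells k) ⊎ (∃[ i ] ∈-some (fresh (i ℕ.+ k)) p)
      descend zero k at = inj₁ at
      descend (suc j) k {p} at with em {P = Any (InsideAt (j ℕ.+ k) p) (cells (j ℕ.+ k))}
      ... | yes parent  = descend j k parent
      ... | no ¬parents = inj₂ (j , concatMap⁺ (λ C → freshIn K C (inside? K C)) (go
        (cells K) ¬parents (concatMap⁻ (quarters (h (suc K))) at)))
        where
        K = j ℕ.+ k
        go : ∀ Cs → ¬ Any (InsideAt K p) Cs →
             Any (λ C → Any (InsideAt (suc K) p) (quarters (h (suc K)) C)) Cs →
             Any (λ C → ∈-some (freshIn K C (inside? K C)) p) Cs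
        go (C ∷ Cs) ¬at (here at) =
          here (freshIn-covers K (inside? K C) (λ q → ¬at (here q)) at)
        go (C ∷ Cs) ¬at (there at) = there (go Cs (λ q → ¬at (there q)) at)

      -- Exhausting an open region by grid cells.

      module _ (openS : IsOpen S) (S⊆ : S ⊆ Square n) where

        eventually-inside : ∀ k {p} → S p → ∃[ j ] Any (InsideAt (j ℕ.+ k) p) (cells (j ℕ.+ k))
        eventually-inside k {p} p∈S with openS p p∈S
        ... | ε , 0<ε , ball with h-small 0<ε k
        ...   | j , 2w<ε = j , Any.map (λ {C} → inside {C}) (locate K (S⊆ p∈S))
          where
          K = j ℕ.+ k
          w = h K
          inside : ∀ {C} → ⟦ cell K C ⟧ p → InsideAt K p C
          inside (x∈ , y∈) = (λ {q} (x′∈ , y′∈) → ball q (begin-strict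
            dist² q p
              ≤⟨ +-mono-≤ (interval-distance x′∈ x∈) (interval-distance y′∈ y∈) ⟩
            w * w + w * w
              -- Doubling the bound turns it into the square of `w + w`, which is what `h-small`
              -- controls.
              ≤⟨ x≤x+y (≤-trans (square-nonNeg w) (x≤x+y (square-nonNeg w))) ⟩
            w * w + w * w + (w * w + w * w)
              ≈⟨ solve 1 (λ w → w :* w :+ w :* w :+ (w :* w :+ w :* w) := (w :+ w) :* (w :+ w)) refl w ⟩
            (w + w) * (w + w)
              <⟨ square-mono-< (≤-trans (0≤h K) (x≤x+y (0≤h K))) 2w<ε ⟩
            ε * ε ∎)) , (x∈ , y∈)

        -- The area of the inner cells not covered by the core, row by row.

        module _ {c : Carrier} (0<c : 0# < c) where

          innerWidth : ℕ → Carrier → List Carrier → Carrier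
          innerWidth k b l = Σₗ l λ a → χ (inside? k (a , b)) (h k)

          -- Cells are closed, but only their interiors are put into the core; these four degenerate
          -- boxes cover the boundary at no cost in area.
          edges : ℕ → Point → List Rectangle
          edges k (a , b) =
            box a ≤-refl b (0≤h k) ∷ box (a + h k) ≤-refl b (0≤h k) ∷
            box a (0≤h k) b ≤-refl ∷ box a (0≤h k) (b + h k) ≤-refl ∷ []

          -- The part of an inner cell not covered by the core, where r is the
          -- width of the inner cells to its right.
          remains : ∀ k C {r} → Dec (Inside k C) → Dec (c ≤ r) → List Rectangle
          remains k C (no  _) _       = []
          remains k C (yes _) (yes _) = edges k C
          remains k C (yes _) (no  _) = cell k C ∷ []

          residue : ℕ → Carrier → List Carrier → List Rectangle
          residue k b []      = []
          residue k b (a ∷ l) =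
            remains k (a , b) (inside? k (a , b)) (c ≤? innerWidth k b l) ++ residue k b l

          total-edges : ∀ k C → total (edges k C) ≈ 0#
          total-edges k (a , b) = begin-equality
            total (edges k (a , b))
              ≈⟨ +-cong (trans (area-box _ ≤-refl _ (0≤h k)) (zeroˡ w))
                (+-cong (trans (area-box _ ≤-refl _ (0≤h k)) (zeroˡ w))
                (+-cong (trans (area-box _ (0≤h k) _ ≤-refl) (zeroʳ w))
                (+-congʳ (trans (area-box _ (0≤h k) _ ≤-refl) (zeroʳ w))))) ⟩
            0# + (0# + (0# + (0# + 0#)))
              ≈⟨ trans (+-identityˡ _) (trans (+-identityˡ _) (trans (+-identityˡ _) (+-identityˡ 0#))) ⟩
            0# ∎
            where w = h k

          total-cell : ∀ k C → total (cell k C ∷ []) ≈ h k * h k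
          total-cell k C = trans (+-identityʳ _) (area-cell k C)

          total-remains≤ : ∀ k C {r} d (e : Dec (c ≤ r)) →
                           total (remains k C d e) ≤ χ d (h k) * h k
          total-remains≤ k C (no  _) _ = ≤-reflexive (sym (zeroˡ (h k)))
          total-remains≤ k C (yes _) (yes _) =
            ≤-trans (≤-reflexive (total-edges k C)) (*-nonNeg (0≤h k) (0≤h k))
          total-remains≤ k C (yes _) (no _) = ≤-reflexive (total-cell k C)

          total-residue≤innerWidth : ∀ k b l → total (residue k b l) ≤ innerWidth k b l * h k
          total-residue≤innerWidth k b [] = ≤-reflexive (sym (zeroˡ (h k)))
          total-residue≤innerWidth k b (a ∷ l) = begin
            total (r ++ residue k b l)
              ≈⟨ Σₗ-++ r (residue k b l) area ⟩
            total r + total (residue k b l)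
              ≤⟨ +-mono-≤ (total-remains≤ k (a , b) d _) (total-residue≤innerWidth k b l) ⟩
            χ d (h k) * h k + innerWidth k b l * h k
              ≈⟨ distribʳ (h k) _ _ ⟨
            (χ d (h k) + innerWidth k b l) * h k ∎
            where
            d = inside? k (a , b)
            r = remains k (a , b) d (c ≤? innerWidth k b l)

          -- Read from the left, inner cells with enough width beyond them leave only edges. At the
          -- first inner cell without it, the inner cells beyond have width less than `c` and are
          -- bounded crudely by `total-residue≤innerWidth`; that cell itself accounts for the extra
          -- `h k`.
          total-residue : ∀ k b l → total (residue k b l) ≤ (c + h k) * h k
          total-residue k b [] =
            *-nonNeg (≤-trans (proj₁ 0<c) (x≤x+y (0≤h k))) (0≤h k)
          total-residue k b (a ∷ l) = begin
            total (remains k (a , b) d e ++ residue k b l)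
              ≈⟨ Σₗ-++ (remains k (a , b) d e) (residue k b l) area ⟩
            total (remains k (a , b) d e) + total (residue k b l)
              ≤⟨ step d e ⟩
            (c + h k) * h k ∎
            where
            d = inside? k (a , b)
            e = c ≤? innerWidth k b l
            step : ∀ d e → total (remains k (a , b) {innerWidth k b l} d e) + total (residue k b l)
                             ≤ (c + h k) * h k
            step (no _) e = ≤-trans (≤-reflexive (+-identityˡ _)) (total-residue k b l)
            step (yes _) (yes _) =
              ≤-trans (≤-reflexive (trans (+-congʳ (total-edges k (a , b))) (+-identityˡ _)))
                      (total-residue k b l)
            step (yes _) (no c≰width) = begin
              total (cell k (a , b) ∷ []) + total (residue k b l)
                ≤⟨ +-mono-≤ (≤-reflexive (total-cell k (a , b))) (total-residue≤innerWidth k b l) ⟩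
              h k * h k + innerWidth k b l * h k
                ≤⟨ +-monoʳ-≤ _ (*-monoʳ-≤ (0≤h k) (proj₁ (≰⇒> c≰width))) ⟩
              h k * h k + c * h k
                ≈⟨ solve 2 (λ h c → h :* h :+ c :* h := (c :+ h) :* h) refl (h k) c ⟩
              (c + h k) * h k ∎

          leftover : ℕ → List Rectangle
          leftover k = concatMap (λ b → residue k b (lefts k)) (lefts k)

          total-leftover : ∀ k → total (leftover k) ≤ (c + h k) * n
          total-leftover k = begin
            total (leftover k)
              ≈⟨ Σₗ-concatMap (λ b → residue k b (lefts k)) (lefts k) area ⟩
            Σₗ (lefts k) (λ b → total (residue k b (lefts k)))
              ≤⟨ Σₗ-mono (lefts k) (λ b → total-residue k b (lefts k)) ⟩
            Σₗ (lefts k) (λ _ → (c + h k) * h k)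
              ≈⟨ Σₗ-*ˡ (lefts k) (c + h k) (λ _ → h k) ⟩
            (c + h k) * Σₗ (lefts k) (λ _ → h k)
              ≈⟨ *-congˡ (Σ-lefts k) ⟩
            (c + h k) * n ∎

          -- Inner cells are glued on one after the other from the right. The same cells serve every
          -- height `y` of the row, since they lie in `S` entirely.
          row-room : ∀ k {b s l y} → Interval b (h k) y → Spaced (h k) s l →
                     Room (λ t → S (t , y)) s (innerWidth k b l)
          row-room k y∈ [] = room-zero
          row-room k {b} {s} {a ∷ l} {y} y∈ (s≤a ∷ spaced) =
            room-weakenˡ s≤a (prepend (inside? k (a , b)))
            where
            prepend : ∀ d → Room (λ t → S (t , y)) a (χ d (h k) + innerWidth k b l)
            prepend (yes inside) = room-glue
              (λ a≤x x<a+w → inside ((a≤x , proj₁ x<a+w) , y∈)) ≤-refl (row-room k y∈ spaced)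
            -- A cell that is not inner adds no width; the start merely moves left across it.
            prepend (no _) = room-resp-≈ (sym (+-identityˡ _))
              (room-weakenˡ (x≤x+y (0≤h k)) (row-room k y∈ spaced))

          -- The piece of the cell to the right of `x` has positive width `v`. Glued in front of the
          -- room of the row, it turns `c ≤ innerWidth k b l` into the strict inequality that
          -- `Roomy` asks for.
          cell-roomy : ∀ k {a b l} → Inside k (a , b) → Spaced (h k) (a + h k) l →
            c ≤ innerWidth k b l →
            ∀ q → OpenBox a (a + h k) b (b + h k) q → Roomy S c q
          cell-roomy k {a} {b} {l} inside spaced c≤width (x , y) ((a<x , x<a+w) , (b<y , y<b+w)) =
            inside ((proj₁ a<x , proj₁ x<a+w) , y∈) ,
            v + innerWidth k b l ,
            ≤-<-trans c≤width (linear-< (x<y⇒0<y-x x<a+w)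
              (trans (+-comm _ _) (sym (+-identityʳ _)))) ,
            room-glue
              (λ x≤t t<x+v → inside ((≤-trans (proj₁ a<x) x≤t , ≤-trans (proj₁ t<x+v) x+v≤) , y∈))
              x+v≤ (row-room k y∈ spaced)
            where
            v = a + h k - x
            y∈ : Interval b (h k) y
            y∈ = proj₁ b<y , proj₁ y<b+w
            x+v≤ : x + v ≤ a + h k
            x+v≤ = ≤-reflexive (trans (+-comm x v) (x-y+y≈x x (a + h k)))

          remains-covers : ∀ k {a b l p} d e → InsideAt k p (a , b) → Spaced (h k) (a + h k) l →
            Core S c p ⊎ ∈-some (remains k (a , b) {innerWidth k b l} d e) p
          remains-covers k (no outside) e (inside , _) spaced = ⊥-elim (outside inside)
          remains-covers k (yes _) (no _) (_ , p∈) spaced = inj₂ (here p∈)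
          remains-covers k {a} {b} {l} {x , y} (yes inside) (yes c≤width) (_ , ((a≤x , x≤) , (b≤y , y≤))) spaced
            with x ≤? a | a + h k ≤? x | y ≤? b | b + h k ≤? y
          -- A degenerate box ends at its start plus zero, which is why `x≤x+y ≤-refl` appears in
          -- the edge cases.
          ... | yes x≤a | _ | _ | _ =
            inj₂ (here ((a≤x , ≤-trans x≤a (x≤x+y ≤-refl)) , (b≤y , y≤)))
          ... | _ | yes r≤x | _ | _ =
            inj₂ (there (here ((r≤x , ≤-trans x≤ (x≤x+y ≤-refl)) , (b≤y , y≤))))
          ... | _ | _ | yes y≤b | _ =
            inj₂ (there (there (here ((a≤x , x≤) , (b≤y , ≤-trans y≤b (x≤x+y ≤-refl))))))
          ... | _ | _ | _ | yes t≤y =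
            inj₂ (there (there (there (here ((a≤x , x≤) , (t≤y , ≤-trans y≤ (x≤x+y ≤-refl)))))))
          ... | no x≰a | no r≰x | no y≰b | no t≰y =
            inj₁ (a , a + h k , b , b + h k ,
                  ((≰⇒> x≰a , ≰⇒> r≰x) , (≰⇒> y≰b , ≰⇒> t≰y)) ,
                  cell-roomy k inside spaced c≤width)

          residue-covers : ∀ k {b s l p} → Spaced (h k) s l →
            Any (λ a → InsideAt k p (a , b)) l → Core S c p ⊎ ∈-some (residue k b l) p
          residue-covers k {b} {l = a ∷ l} (_ ∷ spaced) (here at)
            with remains-covers k (inside? k (a , b)) (c ≤? innerWidth k b l) at spaced
          ... | inj₁ core = inj₁ core
          ... | inj₂ p∈   = inj₂ (++⁺ˡ p∈)
          residue-covers k (_ ∷ spaced) (there at) with residue-covers k spaced at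
          ... | inj₁ core = inj₁ core
          ... | inj₂ p∈   = inj₂ (++⁺ʳ _ p∈)

          leftover-covers : ∀ k {p} → Any (InsideAt k p) (cells k) →
            Core S c p ⊎ ∈-some (leftover k) p
          leftover-covers k at with find at
          ... | (a , b) , C∈ , p∈ with ∈-cells k C∈
          ...   | a∈ , b∈ with residue-covers k (spaced-lefts k) (lose a∈ p∈)
          ...     | inj₁ core = inj₁ core
          ...     | inj₂ p∈r  = inj₂ (concatMap⁺ (λ b → residue k b (lefts k)) (lose b∈ p∈r))

          -- Comparing the measures of the region and its core.

          -- Three families cover `S`: the given cover of the core, the leftover of the inner cells
          -- of level `k`, and the fresh cells from there on. The areas of the last telescope to
          -- differences of inner areas, all at most `L - innerArea k`.
          measure-at-level : ∀ {finite R a L} → Covers R (Core S c) → HasTotalArea R a →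
            (∀ k → innerArea k ≤ L) →
            ∀ k → μ₂ S finite ≤ a + ((c + h k) * n + (L - innerArea k))
          measure-at-level {finite} {R} {L = L} covers R-total innerArea≤L k =
            μ₂≤ {S} {finite} {R} {G = λ j → fresh (j ℕ.+ k)} {rs = leftover k} R-total bounded covered
            where
            bounded : ∀ K → total (leftover k) + ∑[ j < K ] total (fresh (toℕ j ℕ.+ k))
                              ≤ (c + h k) * n + (L - innerArea k)
            bounded K = +-mono-≤ (total-leftover k) (+-cancelʳ-≤ (innerArea k) (begin
              tail + innerArea k
                ≈⟨ +-comm tail (innerArea k) ⟩
              innerArea k + tail
                ≈⟨ ∑-telescope (λ j → innerArea (j ℕ.+ k)) (λ j → total (fresh (j ℕ.+ k)))
                     (λ j → innerArea-suc (j ℕ.+ k)) K ⟩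
              innerArea (K ℕ.+ k)
                ≤⟨ innerArea≤L (K ℕ.+ k) ⟩
              L
                ≈⟨ x-y+y≈x (innerArea k) L ⟨
              L - innerArea k + innerArea k ∎))
              where tail = ∑[ j < K ] total (fresh (toℕ j ℕ.+ k))

            covered : ∀ {p} → S p → (∃[ i ] ⟦ R i ⟧ p) ⊎ ∈-some (leftover k) p ⊎
                                    (∃[ j ] ∈-some (fresh (j ℕ.+ k)) p)
            covered p∈S with eventually-inside k p∈S
            ... | j , at with descend j k at
            ...   | inj₂ p∈fresh = inj₂ (inj₂ p∈fresh)
            ...   | inj₁ at-k with leftover-covers k at-k
            ...     | inj₁ core = inj₁ (covers core)
            ...     | inj₂ p∈   = inj₂ (inj₁ p∈)

          measure-cover : ∀ {finite a} → CoverArea (Core S c) a → μ₂ S finite ≤ a + c * n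
          measure-cover {finite} {a} (R , covers , R-total) =
            -- With `L` the supremum of the inner areas, it suffices that `a + c * n + L - m` bounds
            -- them too: then it is at least `L`, and `L` cancels.
            linear-≤ (L-least (a + c * n + L - m) λ x (k , x≈) →
                        ≤-trans (≤-reflexive x≈) (innerArea≤ k))
              (begin-equality
                m + (a + c * n + L - m)   ≈⟨ +-comm m _ ⟩
                a + c * n + L - m + m     ≈⟨ x-y+y≈x m _ ⟩
                a + c * n + L             ∎)
            where
            m = μ₂ S finite
            sup = complete (λ x → ∃[ k ] x ≈ innerArea k) (innerArea 0 , 0 , refl)
              (n * n , λ x (k , x≈) → ≤-trans (≤-reflexive x≈) (innerArea≤n² k))
            L = proj₁ sup
            innerArea≤L : ∀ k → innerArea k ≤ L
            innerArea≤L k = proj₁ (proj₂ sup) _ (k , refl)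
            L-least = proj₂ (proj₂ sup)

            level : ∀ k → m + innerArea k ≤ h k * n + (a + c * n + L)
            level k = begin
              m + A
                ≤⟨ +-monoˡ-≤ A (measure-at-level {finite} {R} covers R-total innerArea≤L k) ⟩
              a + ((c + h k) * n + (L - A)) + A
                ≈⟨ solve 6 (λ a c h n d A → a :+ ((c :+ h) :* n :+ d) :+ A :=
                                            h :* n :+ (a :+ c :* n :+ (d :+ A)))
                     refl a c (h k) n (L - A) A ⟩
              h k * n + (a + c * n + (L - A + A))
                ≈⟨ +-congˡ (+-congˡ (x-y+y≈x A L)) ⟩
              h k * n + (a + c * n + L) ∎
              where A = innerArea k

            innerArea≤ : ∀ k → innerArea k ≤ a + c * n + L - m
            innerArea≤ k = +-cancelʳ-≤ m (begin
              innerArea k + m           ≈⟨ +-comm _ m ⟩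
              m + innerArea k           ≤⟨ linear-≤ excess≤0 (trans (+-identityʳ _)
                                           (sym (trans (+-comm B _) (x-y+y≈x B _)))) ⟩
              B                         ≈⟨ x-y+y≈x m B ⟨
              B - m + m                 ∎)
              where
              B = a + c * n + L
              -- Inner areas increase with the level, so for fixed `k` the excess is bounded by the
              -- error term `h (j + k) * n` of every finer level, which halves at each step.
              excess≤0 : m + innerArea k - B ≤ 0#
              excess≤0 = halving-limit {s = λ j → h (j ℕ.+ k) * n}
                (λ j → trans (*-congʳ (h-half (j ℕ.+ k))) (distribʳ n _ _))
                λ j → +-cancelʳ-≤ B (begin
                  m + innerArea k - B + B       ≈⟨ x-y+y≈x B _ ⟩
                  m + innerArea k               ≤⟨ +-monoʳ-≤ m (innerArea-mono j k) ⟩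
                  m + innerArea (j ℕ.+ k)       ≤⟨ level (j ℕ.+ k) ⟩
                  h (j ℕ.+ k) * n + B           ∎)

          -- By `measure-cover`, `m - c * n` is a lower bound for the areas of covers of the core,
          -- hence at most their infimum.
          measure-core : ∀ {finite finite′} → μ₂ S finite ≤ μ₂ (Core S c) finite′ + c * n
          measure-core {finite} {finite′} =
            ≤-trans (≤-reflexive (sym (x-y+y≈x (c * n) m)))
              (+-monoˡ-≤ (c * n) (proj₂ (μ₂-isInf (Core S c) finite′) (m - c * n)
                λ a cover → +-cancelʳ-≤ (c * n) (≤-trans
                  (≤-reflexive (x-y+y≈x (c * n) m)) (measure-cover cover))))
            where m = μ₂ S finite

-- The bound for `opx`.

lemma2p9 : (em : ∀ {ℓ} → ExcludedMiddle ℓ) (ℝ : CompleteOrderedField) →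
  let open CompleteOrderedField ℝ
      open Plane ℝ
  in (P : Region) → P Respects _≈₂_ →
     (x₀ y₀ c : Carrier) → IsMax (XCoords P) x₀ → 0# < c →
     (p∈P : P (x₀ , y₀)) →
     (n : Carrier) (0<n : 0# < n) →
     opx 0<n (P ∪ HorizontalSegment c (x₀ , y₀)) (_ , inj₁ p∈P)
       ≤ opx 0<n P (_ , p∈P) + c * n
lemma2p9 em ℝ P _ x₀ y₀ c rightmost 0<c p∈P n 0<n =
  -- It suffices to bound the measure of each competitor `S` for the enlarged set. Its core competes
  -- for `P`, as a containment of `P` in it would extend to one in `S`.
  proj₂ (opx-isSup 0<n _ (_ , inj₁ p∈P)) _ λ m (S , openS , free , S⊆ , m≈μ) →
    let core⊆ : Core S c ⊆ Square n
        core⊆ q∈ = S⊆ (proj₁ (Core⊆Roomy q∈))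
        core-free : Core S c IsFreeOf P
        core-free contains = free (extend rightmost p∈P contains)
    in begin
      m
        ≈⟨ m≈μ ⟩
      μ₂ S (finite (proj₁ 0<n) S⊆)
        ≤⟨ measure-core (proj₁ 0<n) S openS S⊆ 0<c ⟩
      μ₂ (Core S c) (finite (proj₁ 0<n) core⊆) + c * n
        ≤⟨ +-monoˡ-≤ (c * n) (proj₁ (opx-isSup 0<n P (_ , p∈P)) _
             (Core S c , IsOpen-Core S c , core-free , core⊆ , refl)) ⟩
      opx 0<n P (_ , p∈P) + c * n ∎
  where
  open CompleteOrderedField ℝ
  open Plane ℝ
  open OrderedFieldProperties em ℝ
  open Geometry em ℝ
  open Extension em ℝ
  open Grid em ℝ
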